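{- Let $D\ge 1$ and $N>2D$ be integers, let $q$ be a prime power, let $\Gamma=J_q(N,D)$ with adjacency matrix $A$, and let $x$ be a vertex of $\Gamma$. For every subspace $\alpha\subseteq x$, with $i=\dim\alpha$, $$A\alpha^{\vee}=\theta_i\,\alpha^{\vee}+[D-i+1]\sum_{\alpha\text{ covers }\beta}\beta^{\vee}.$$
   Context: Let $\mathbb{F}_q$ be a finite field with $q$ elements and $\mathcal{V}$ an $N$-dimensional vector space over $\mathbb{F}_q$. The Grassmann graph $\Gamma=J_q(N,D)$ has vertex set $X$ consisting of the $D$-dimensional subspaces of $\mathcal{V}$; $y,z\in X$ are adjacent iff $\dim(y\cap z)=D-1$. $[\ell]=\frac{q^\ell-1}{q-1}$ for integers $\ell$. The eigenvalues of $\Gamma$ are $\theta_i=q[D][N-D]-[i][N-i+1]$ for $0\le i\le D$. For subspaces $u,v$ of $\mathcal{V}$, $v$ covers $u$ means $u\subseteq v$ and $\dim v=\dim u+1$. Let $V=\mathbb{C}^X$ (column vectors), and for $y\in X$ let $\widehat y\in V$ have $1$ in coordinate $y$ and $0$ elsewhere. For a subspace $\alpha\subseteq x$, $\alpha^{\vee}=\sum_{y\in X,\ \alpha\subseteq y}\widehat y$. The sum in the claim runs over all subspaces $\beta$ covered by $\alpha$. -}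

module Defs where

open import Algebra.Apartness.Bundles using (HeytingField; HeytingCommutativeRing)
open import Algebra.Bundles using (CommutativeRing)
open import Algebra.Module.Bundles using (Module)
import Algebra.Definitions.RawMonoid as RawMonoidDefs
import Algebra.Properties.CommutativeMonoid.Sum as Summation
import Algebra.Properties.Group as GroupProperties
open import Data.Bool.Base using (if_then_else_)
open import Data.Fin.Base as Fin using (Fin; zero; suc)
import Data.Fin.Properties as Fin
open import Data.Integer.Base as ℤ using (ℤ; -[1+_]) renaming (+_ to pos)
open import Data.List.Base as List using (List; []; _∷_; cartesianProductWith; deduplicate)
import Data.List.Membership.Setoid.Properties as Membership
open import Data.List.Relation.Unary.All as All using (All; []; _∷_)
open import Data.List.Relation.Unary.AllPairs using ([]; _∷_)
open import Data.List.Relation.Unary.Any as Any using (here; there)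
import Data.List.Relation.Unary.Any.Properties as Any
open import Data.List.Relation.Unary.Enumerates.Setoid using (IsEnumeration)
import Data.List.Relation.Unary.Enumerates.Setoid.Properties as Enumerates
open import Data.List.Relation.Unary.Unique.Setoid using (Unique)
import Data.List.Relation.Unary.Unique.DecSetoid.Properties as UniqueDec
open import Data.Nat.Base as ℕ using (ℕ; zero; suc; NonZero; _∸_; _^_)
open import Data.Nat.DivMod using (_/_)
open import Data.Nat.Primality using (Prime)
open import Data.Product.Base using (∃; ∃-syntax; Σ; _×_; _,_; proj₁; proj₂)
open import Data.Unit.Base using (tt)
open import Data.Vec.Functional using (Vector; head; tail) renaming (_∷_ to _◂_)
import Data.Vec.Functional.Relation.Binary.Equality.Setoid as VecEquality
open import Function.Base using (_∘_)
open import Function.Bundles using (Inverse)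
open import Level using (Level; _⊔_) renaming (suc to lsuc)
open import Relation.Binary.Bundles using (Setoid; DecSetoid)
import Relation.Binary.Construct.On as On
open import Relation.Binary.Definitions using (_Respects_) renaming (Decidable to Decidable₂)
open import Relation.Binary.PropositionalEquality as ≡ using (_≡_)
open import Relation.Nullary using (Dec; yes; no; ¬_; contradiction)
open import Relation.Nullary.Decidable using (⌊_⌋; map′; _×-dec_; _→-dec_; decidable-stable)
open import Relation.Unary using (Pred; Decidable; U)

private variable
  a b f k m ℓ ℓ₁ ℓ₂ ℓk ℓm p : Level

record Enumeration (S : Setoid a ℓ) : Set (a ⊔ ℓ) where
  field
    list     : List (Setoid.Carrier S)
    complete : IsEnumeration S list
    unique   : Unique S list

subsetoid : (S : Setoid a ℓ) → Pred (Setoid.Carrier S) p → Setoid (a ⊔ p) ℓ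
subsetoid S P = On.setoid {B = Σ (Setoid.Carrier S) P} S proj₁

module _ {A : Set a} {P : Pred A p} (P? : Decidable P) where

  restrictList : List A → List (∃ P)
  restrictList []       = []
  restrictList (x ∷ xs) with P? x
  ... | yes px = (x , px) ∷ restrictList xs
  ... | no  _  = restrictList xs

  All-restrictList : {Q : Pred A b} {xs : List A} → All Q xs → All (Q ∘ proj₁) (restrictList xs)
  All-restrictList []                 = []
  All-restrictList {xs = x ∷ _} (qx ∷ qxs) with P? x
  ... | yes _ = qx ∷ All-restrictList qxs
  ... | no  _ = All-restrictList qxs

restrict : {S : Setoid a ℓ} {P : Pred (Setoid.Carrier S) p} →
           P Respects (Setoid._≈_ S) → Decidable P → Enumeration S → Enumeration (subsetoid S P)
restrict {S = S} {P = P} resp P? E = record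
  { list     = restrictList P? list
  ; complete = λ (x , px) → complete′ px (complete x)
  ; unique   = unique′ unique
  }
  where
  open Enumeration E
  open Setoid S using (_≈_; sym) renaming (Carrier to A)

  complete′ : ∀ {x} {xs : List A} → P x → Any.Any (x ≈_) xs →
              Any.Any (λ y → x ≈ proj₁ y) (restrictList P? xs)
  complete′ {xs = y ∷ _} px (here x≈y) with P? y
  ... | yes _  = here x≈y
  ... | no ¬py = contradiction (resp x≈y px) ¬py
  complete′ {xs = y ∷ _} px (there x∈) with P? y
  ... | yes _ = there (complete′ px x∈)
  ... | no  _ = complete′ px x∈

  unique′ : ∀ {xs} → Unique S xs → Unique (subsetoid S P) (restrictList P? xs)
  unique′ []                   = []
  unique′ {x ∷ _} (x∉ ∷ xs!) with P? x
  ... | yes _ = All-restrictList P? x∉ ∷ unique′ xs!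
  ... | no  _ = unique′ xs!

dedup : (S : DecSetoid a ℓ) {xs : List (DecSetoid.Carrier S)} →
        IsEnumeration (DecSetoid.setoid S) xs → Enumeration (DecSetoid.setoid S)
dedup S {xs} xs-complete = record
  { list     = deduplicate (DecSetoid._≟_ S) xs
  ; complete = Enumerates.deduplicate⁺ S xs-complete
  ; unique   = UniqueDec.deduplicate-! S xs
  }

module Search (S : Setoid a ℓ) {xs : List (Setoid.Carrier S)} (xs-complete : IsEnumeration S xs) where
  open Setoid S using (_≈_) renaming (Carrier to A)

  ∃? : {P : Pred A p} → P Respects _≈_ → Decidable P → Dec (∃ P)
  ∃? resp P? = map′ Any.satisfied
    (λ (x , px) → Any.map (λ x≈y → resp x≈y px) (xs-complete x)) (Any.any? P? xs)

  ∀? : {P : Pred A p} → P Respects _≈_ → Decidable P → Dec (∀ x → P x)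
  ∀? {P = P} resp P? = map′
    (λ all x → All.lookupWith (λ Py x≈y → resp (Setoid.sym S x≈y) Py) all (xs-complete x))
    (λ all → All.universal all xs) (All.all? P? xs)

module Tuples (S : Setoid a ℓ) where
  open Setoid S renaming (Carrier to A)
  open VecEquality S using (≋-setoid)

  tuples : List A → ∀ n → List (Vector A n)
  tuples xs zero    = (λ ()) ∷ []
  tuples xs (suc n) = cartesianProductWith _◂_ xs (tuples xs n)

  tuples-complete : ∀ {xs} → IsEnumeration S xs → ∀ n → IsEnumeration (≋-setoid n) (tuples xs n)
  tuples-complete xs-complete zero    t = here λ ()
  tuples-complete xs-complete (suc n) t =
    Any.cartesianProductWith⁺ _◂_
      (λ where p q zero → p
               p q (suc i) → q i)
      (xs-complete (head t)) (tuples-complete xs-complete n (tail t))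

-- In a finite field equality is decidable, so the apartness of `HeytingField`,
-- which says that the difference is invertible, amounts to inequality.
fieldRing : HeytingField f ℓ₁ ℓ₂ → CommutativeRing f ℓ₁
fieldRing F = HeytingCommutativeRing.commutativeRing (HeytingField.heytingCommutativeRing F)

HasSize : HeytingField f ℓ₁ ℓ₂ → ℕ → Set (f ⊔ ℓ₁)
HasSize F q = Inverse (CommutativeRing.setoid (fieldRing F)) (≡.setoid (Fin q))

IsPrimePower : ℕ → Set
IsPrimePower q = ∃[ p ] ∃[ e ] Prime p × 1 ℕ.≤ e × q ≡ p ^ e

VectorSpace : HeytingField f ℓ₁ ℓ₂ → ∀ m ℓm → Set (f ⊔ ℓ₁ ⊔ lsuc (m ⊔ ℓm))
VectorSpace F = Module (fieldRing F)

module LinearAlgebra (F : HeytingField f ℓ₁ ℓ₂) (𝒱 : VectorSpace F m ℓm) where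
  open CommutativeRing (fieldRing F) using (_≈_; 0#; 1#) renaming (Carrier to 𝔽)
  open Module 𝒱
  open Summation +ᴹ-commutativeMonoid using (sum)

  combination : ∀ {n} → Vector 𝔽 n → Vector Carrierᴹ n → Carrierᴹ
  combination c v = sum λ i → c i *ₗ v i

  InSpan : ∀ {n} → Vector Carrierᴹ n → Pred Carrierᴹ (f ⊔ ℓm)
  InSpan v w = ∃[ c ] w ≈ᴹ combination c v

  LinearlyIndependent : ∀ {n} → Vector Carrierᴹ n → Set (f ⊔ ℓ₁ ⊔ ℓm)
  LinearlyIndependent v = ∀ c → combination c v ≈ᴹ 0ᴹ → ∀ i → c i ≈ 0#

  record IsBasis (P : Pred Carrierᴹ p) {n} (v : Vector Carrierᴹ n) : Set (f ⊔ ℓ₁ ⊔ m ⊔ ℓm ⊔ p) where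
    constructor mkIsBasis
    field
      contained   : ∀ i → P (v i)
      independent : LinearlyIndependent v
      spanning    : ∀ w → P w → InSpan v w

  -- The dimension as a relation, meaningful for P a linear subspace.
  HasDim : Pred Carrierᴹ p → ℕ → Set (f ⊔ ℓ₁ ⊔ m ⊔ ℓm ⊔ p)
  HasDim P n = ∃[ v ] IsBasis P {n} v

  -- Decidability is automatic classically; constructively it is what makes
  -- the subspaces of a finite vector space enumerable.
  record Subspace : Set (m ⊔ lsuc (f ⊔ ℓm)) where
    field
      contains : Pred Carrierᴹ (f ⊔ ℓm)
      resp     : contains Respects _≈ᴹ_
      0-closed : contains 0ᴹ
      +-closed : ∀ {v w} → contains v → contains w → contains (v +ᴹ w)
      *-closed : ∀ r {v} → contains v → contains (r *ₗ v)
      dec      : Decidable contains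

  open Subspace public using (contains)

  dim_≡_ : Subspace → ℕ → Set (f ⊔ ℓ₁ ⊔ m ⊔ ℓm)
  dim u ≡ n = HasDim (contains u) n

  infix 4 _⊆_ _≐_ _covers_
  infixr 7 _∩_

  _⊆_ : Subspace → Subspace → Set (f ⊔ m ⊔ ℓm)
  u ⊆ v = ∀ w → contains u w → contains v w

  _≐_ : Subspace → Subspace → Set (f ⊔ m ⊔ ℓm)
  u ≐ v = u ⊆ v × v ⊆ u

  _∩_ : Subspace → Subspace → Subspace
  u ∩ v = record
    { contains = λ w → u.contains w × v.contains w
    ; resp     = λ w≈w′ (p , q) → u.resp w≈w′ p , v.resp w≈w′ q
    ; 0-closed = u.0-closed , v.0-closed
    ; +-closed = λ (p , q) (p′ , q′) → u.+-closed p p′ , v.+-closed q q′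
    ; *-closed = λ r (p , q) → u.*-closed r p , v.*-closed r q
    ; dec      = λ w → u.dec w ×-dec v.dec w
    }
    where
    module u = Subspace u
    module v = Subspace v

  _covers_ : Subspace → Subspace → Set (f ⊔ ℓ₁ ⊔ m ⊔ ℓm)
  v covers u = u ⊆ v × ∃[ d ] (dim u ≡ d × dim v ≡ suc d)

  subspaceSetoid : Setoid (m ⊔ lsuc (f ⊔ ℓm)) (f ⊔ m ⊔ ℓm)
  subspaceSetoid = record
    { Carrier       = Subspace
    ; _≈_           = _≐_
    ; isEquivalence = record
      { refl  = (λ _ p → p) , (λ _ p → p)
      ; sym   = λ (p , q) → q , p
      ; trans = λ (p , q) (p′ , q′) → (λ w → p′ w ∘ p w) , (λ w → q w ∘ q′ w)
      }
    }

module FiniteLinearAlgebra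
  (F : HeytingField f ℓ₁ ℓ₂) {q : ℕ} (size : HasSize F q)
  (𝒱 : VectorSpace F m ℓm) {N : ℕ} (dim𝒱 : LinearAlgebra.HasDim F 𝒱 U N)
  where

  open LinearAlgebra F 𝒱 public
  open HeytingField F using (#-irrefl; invertible⇒#)
  open CommutativeRing (fieldRing F)
    using (_≈_; _+_; _*_; _-_; 0#; 1#; setoid) renaming (Carrier to 𝔽)
  open Module 𝒱
  open Summation +ᴹ-commutativeMonoid using (sum; sum-cong-≋; sum-replicate-zero; ∑-distrib-+)
  open Inverse size
  private
    module R = CommutativeRing (fieldRing F)
    module T𝔽 = Tuples setoid
    module T𝒱 = Tuples ≈ᴹ-setoid
    module V𝔽 = VecEquality setoid
    module V𝒱 = VecEquality ≈ᴹ-setoid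

  1≉0 : ¬ 1# ≈ 0#
  1≉0 1≈0 = #-irrefl 1≈0 (invertible⇒# (1# , R.trans (R.*-identityˡ _) 1-0≈1 , R.trans (R.*-identityʳ _) 1-0≈1))
    where
    1-0≈1 : 1# - 0# ≈ 1#
    1-0≈1 = R.trans (R.+-congˡ (GroupProperties.ε⁻¹≈ε R.+-group)) (R.+-identityʳ 1#)

  to-injective : ∀ {x y} → to x ≡ to y → x ≈ y
  to-injective {x} {y} eq = R.trans (R.sym (strictlyInverseʳ x)) (R.trans (from-cong eq) (strictlyInverseʳ y))

  q-1≢0 : NonZero (q ∸ 1)
  q-1≢0 = aux q (to 1#) (to 0#) (1≉0 ∘ to-injective)
    where
    aux : ∀ n (i j : Fin n) → ¬ i ≡ j → NonZero (n ∸ 1)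
    aux 1             zero zero i≢j = contradiction ≡.refl i≢j
    aux (suc (suc _)) _    _    _   = _

  _≟_ : Decidable₂ _≈_
  x ≟ y = map′ to-injective to-cong (to x Fin.≟ to y)

  scalars : List 𝔽
  scalars = List.tabulate from

  scalars-complete : IsEnumeration setoid scalars
  scalars-complete x = Membership.∈-resp-≈ setoid (strictlyInverseʳ x) (Membership.∈-tabulate⁺ setoid (to x))

  combination-cong : ∀ {n} {c d : Vector 𝔽 n} {v w : Vector Carrierᴹ n} →
                     (∀ i → c i ≈ d i) → (∀ i → v i ≈ᴹ w i) → combination c v ≈ᴹ combination d w
  combination-cong c≈d v≈w = sum-cong-≋ λ i → *ₗ-cong (c≈d i) (v≈w i)

  combination-zero : ∀ {n} {c : Vector 𝔽 n} (v : Vector Carrierᴹ n) →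
                     (∀ i → c i ≈ 0#) → combination c v ≈ᴹ 0ᴹ
  combination-zero {n} v c≈0 =
    ≈ᴹ-trans (sum-cong-≋ λ i → ≈ᴹ-trans (*ₗ-cong (c≈0 i) ≈ᴹ-refl) (*ₗ-zeroˡ (v i))) (sum-replicate-zero n)

  combination-+ : ∀ {n} (c d : Vector 𝔽 n) (v : Vector Carrierᴹ n) →
                  combination c v +ᴹ combination d v ≈ᴹ combination (λ i → c i + d i) v
  combination-+ c d v = ≈ᴹ-trans
    (≈ᴹ-sym (∑-distrib-+ (λ i → c i *ₗ v i) (λ i → d i *ₗ v i)))
    (sum-cong-≋ λ i → ≈ᴹ-sym (*ₗ-distribʳ (v i) (c i) (d i)))

  combination-* : ∀ {n} r (c : Vector 𝔽 n) (v : Vector Carrierᴹ n) →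
                  r *ₗ combination c v ≈ᴹ combination (λ i → r * c i) v
  combination-* {zero}  r c v = *ₗ-zeroʳ r
  combination-* {suc n} r c v = ≈ᴹ-trans (*ₗ-distribˡ r _ _)
    (+ᴹ-cong (≈ᴹ-sym (*ₗ-assoc r (c zero) (v zero))) (combination-* r (tail c) (tail v)))

  combination-closed : ∀ (u : Subspace) {n} (c : Vector 𝔽 n) (v : Vector Carrierᴹ n) →
                       (∀ i → contains u (v i)) → contains u (combination c v)
  combination-closed u {zero}  c v v∈u = Subspace.0-closed u
  combination-closed u {suc n} c v v∈u =
    Subspace.+-closed u (Subspace.*-closed u (c zero) (v∈u zero))
                        (combination-closed u (tail c) (tail v) (v∈u ∘ suc))

  δ : ∀ {n} → Fin n → Vector 𝔽 n
  δ zero    = 1# ◂ λ _ → 0#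
  δ (suc i) = 0# ◂ δ i

  δ-diagonal : ∀ {n} (i : Fin n) → δ i i ≡ 1#
  δ-diagonal zero    = ≡.refl
  δ-diagonal (suc i) = δ-diagonal i

  δ-off-diagonal : ∀ {n} (i j : Fin n) → ¬ i ≡ j → δ i j ≡ 0#
  δ-off-diagonal zero    zero    i≢j = contradiction ≡.refl i≢j
  δ-off-diagonal zero    (suc j) i≢j = ≡.refl
  δ-off-diagonal (suc i) zero    i≢j = ≡.refl
  δ-off-diagonal (suc i) (suc j) i≢j = δ-off-diagonal i j (i≢j ∘ ≡.cong suc)

  combination-δ : ∀ {n} (v : Vector Carrierᴹ n) i → combination (δ i) v ≈ᴹ v i
  combination-δ v zero    = ≈ᴹ-trans
    (+ᴹ-cong (*ₗ-identityˡ (v zero)) (combination-zero (tail v) λ _ → R.refl)) (+ᴹ-identityʳ _)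
  combination-δ v (suc i) = ≈ᴹ-trans
    (+ᴹ-cong (*ₗ-zeroˡ (v zero)) (combination-δ (tail v) i)) (+ᴹ-identityˡ _)

  independent⇒injective : ∀ {n} {v : Vector Carrierᴹ n} → LinearlyIndependent v →
                          ∀ {i j} → v i ≈ᴹ v j → i ≡ j
  independent⇒injective {n} {v} indep {i} {j} vi≈vj = decidable-stable (i Fin.≟ j) λ i≢j →
    1≉0 (R.trans (R.sym (c-i i≢j)) (indep c c≈0 i))
    where
    c : Vector 𝔽 n
    c k = δ i k + (R.- 1#) * δ j k

    c≈0 : combination c v ≈ᴹ 0ᴹ
    c≈0 = ≈ᴹ-trans (≈ᴹ-sym (combination-+ (δ i) _ v)) (≈ᴹ-trans
      (+ᴹ-cong
        (≈ᴹ-trans (combination-δ v i) (≈ᴹ-trans vi≈vj (≈ᴹ-sym (*ₗ-identityˡ (v j)))))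
        (≈ᴹ-trans (≈ᴹ-sym (combination-* (R.- 1#) (δ j) v)) (*ₗ-cong R.refl (combination-δ v j))))
      (≈ᴹ-trans (≈ᴹ-sym (*ₗ-distribʳ (v j) 1# (R.- 1#)))
        (≈ᴹ-trans (*ₗ-cong (R.-‿inverseʳ 1#) ≈ᴹ-refl) (*ₗ-zeroˡ (v j)))))

    c-i : ¬ i ≡ j → c i ≈ 1#
    c-i i≢j = R.trans
      (R.+-cong (R.reflexive (δ-diagonal i))
        (R.trans (R.*-congˡ (R.reflexive (δ-off-diagonal j i (i≢j ∘ ≡.sym)))) (R.zeroʳ _)))
      (R.+-identityʳ 1#)

  private
    e     = proj₁ dim𝒱
    module e = IsBasis (proj₂ dim𝒱)

  zero? : Decidable (_≈ᴹ 0ᴹ)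
  zero? v = let c , v≈ = e.spanning v tt in
    map′ (λ c≈0 → ≈ᴹ-trans v≈ (combination-zero e c≈0))
         (λ v≈0 → e.independent c (≈ᴹ-trans (≈ᴹ-sym v≈) v≈0))
         (Fin.all? λ i → c i ≟ 0#)

  _≟ᴹ_ : Decidable₂ _≈ᴹ_
  v ≟ᴹ w = map′ (GroupProperties.x∙y⁻¹≈ε⇒x≈y +ᴹ-group v w)
                (λ v≈w → ≈ᴹ-trans (+ᴹ-cong v≈w ≈ᴹ-refl) (-ᴹ‿inverseʳ w))
                (zero? (v +ᴹ (-ᴹ w)))

  vectors : List Carrierᴹ
  vectors = List.map (λ c → combination c e) (T𝔽.tuples scalars N)

  vectors-complete : IsEnumeration ≈ᴹ-setoid vectors
  vectors-complete v = let c , v≈ = e.spanning v tt in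
    Membership.∈-resp-≈ ≈ᴹ-setoid (≈ᴹ-sym v≈)
      (Membership.∈-map⁺ (V𝔽.≋-setoid N) ≈ᴹ-setoid (λ c≈d → combination-cong c≈d λ _ → ≈ᴹ-refl)
        (T𝔽.tuples-complete scalars-complete N c))

  private
    module S𝒱 = Search ≈ᴹ-setoid vectors-complete
    module S𝔽ⁿ n = Search (V𝔽.≋-setoid n) (T𝔽.tuples-complete scalars-complete n)
    module S𝒱ⁿ n = Search (V𝒱.≋-setoid n) (T𝒱.tuples-complete vectors-complete n)

  inSpan? : ∀ {n} (v : Vector Carrierᴹ n) → Decidable (InSpan v)
  inSpan? v w = S𝔽ⁿ.∃? _ (λ c≈d w≈ → ≈ᴹ-trans w≈ (combination-cong c≈d λ _ → ≈ᴹ-refl))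
                         (λ c → w ≟ᴹ combination c v)

  linearlyIndependent? : ∀ {n} (v : Vector Carrierᴹ n) → Dec (LinearlyIndependent v)
  linearlyIndependent? v = S𝔽ⁿ.∀? _
    (λ c≈d indep d≈0 i → R.trans (R.sym (c≈d i)) (indep (≈ᴹ-trans (combination-cong c≈d λ _ → ≈ᴹ-refl) d≈0) i))
    (λ c → zero? (combination c v) →-dec Fin.all? λ i → c i ≟ 0#)

  span : ∀ {n} → Vector Carrierᴹ n → Subspace
  span v = record
    { contains = InSpan v
    ; resp     = λ w≈w′ (c , w≈) → c , ≈ᴹ-trans (≈ᴹ-sym w≈w′) w≈
    ; 0-closed = (λ _ → 0#) , ≈ᴹ-sym (combination-zero v λ _ → R.refl)
    ; +-closed = λ (c , p) (d , q) → _ , ≈ᴹ-trans (+ᴹ-cong p q) (combination-+ c d v)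
    ; *-closed = λ r (c , p) → _ , ≈ᴹ-trans (*ₗ-cong R.refl p) (combination-* r c v)
    ; dec      = inSpan? v
    }

  isBasis-resp : ∀ (u : Subspace) {n} {v w : Vector Carrierᴹ n} →
                 (∀ i → v i ≈ᴹ w i) → IsBasis (contains u) v → IsBasis (contains u) w
  isBasis-resp u v≈w (mkIsBasis in-u indep spans) = mkIsBasis
    (λ i → Subspace.resp u (v≈w i) (in-u i))
    (λ c c≈0 → indep c (≈ᴹ-trans (combination-cong (λ _ → R.refl) v≈w) c≈0))
    (λ x x∈u → let c , x≈ = spans x x∈u in c , ≈ᴹ-trans x≈ (combination-cong (λ _ → R.refl) v≈w))

  isBasis? : ∀ (u : Subspace) {n} (v : Vector Carrierᴹ n) → Dec (IsBasis (contains u) v)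
  isBasis? u v = map′ (λ (p , q , r) → mkIsBasis p q r) (λ (mkIsBasis p q r) → p , q , r)
    (Fin.all? (λ i → Subspace.dec u (v i)) ×-dec linearlyIndependent? v ×-dec
     S𝒱.∀? (λ x≈y s y∈u → Subspace.resp (span v) x≈y (s (Subspace.resp u (≈ᴹ-sym x≈y) y∈u)))
           (λ w → Subspace.dec u w →-dec inSpan? v w))

  dim? : ∀ (u : Subspace) n → Dec (dim u ≡ n)
  dim? u n = S𝒱ⁿ.∃? n (isBasis-resp u) (isBasis? u)

  dim-resp : ∀ {n} {u v : Subspace} → u ≐ v → dim u ≡ n → dim v ≡ n
  dim-resp (u⊆v , v⊆u) (b , mkIsBasis in-u indep spans) =
    b , mkIsBasis (λ i → u⊆v _ (in-u i)) indep (λ w w∈v → spans w (v⊆u w w∈v))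

  _⊆?_ : Decidable₂ _⊆_
  u ⊆? v = S𝒱.∀? (λ x≈y s y∈u → Subspace.resp v x≈y (s (Subspace.resp u (≈ᴹ-sym x≈y) y∈u)))
                 (λ w → Subspace.dec u w →-dec Subspace.dec v w)

  subspaceDecSetoid : DecSetoid (m ⊔ lsuc (f ⊔ ℓm)) (f ⊔ m ⊔ ℓm)
  subspaceDecSetoid = record
    { isDecEquivalence = record
      { isEquivalence = Setoid.isEquivalence subspaceSetoid
      ; _≟_           = λ u v → u ⊆? v ×-dec v ⊆? u
      } }

  open DecSetoid subspaceDecSetoid public using () renaming (_≟_ to _≐?_)

  -- Every subspace is spanned by the (redundant) family of all its vectors,
  -- padded with 0 to the length of `vectors`.
  subspaces : Enumeration subspaceSetoid
  subspaces = dedup subspaceDecSetoid {List.map span (T𝒱.tuples vectors n)} λ u →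
    Membership.∈-resp-≈ subspaceSetoid {x = span (generators u)} {y = u}
      (span⊆u u , u⊆span u)
      (Membership.∈-map⁺ (V𝒱.≋-setoid n) subspaceSetoid {f = span} span-cong
        (T𝒱.tuples-complete vectors-complete n (generators u)))
    where
    n = List.length vectors

    span-cong : ∀ {v w : Vector Carrierᴹ n} → (∀ i → v i ≈ᴹ w i) → span v ≐ span w
    span-cong v≈w =
      (λ x (c , x≈) → c , ≈ᴹ-trans x≈ (combination-cong (λ _ → R.refl) v≈w)) ,
      (λ x (c , x≈) → c , ≈ᴹ-trans x≈ (combination-cong (λ _ → R.refl) (≈ᴹ-sym ∘ v≈w)))

    generator : ∀ (u : Subspace) v → ∃[ w ] (contains u w × (contains u v → w ≈ᴹ v))
    generator u v with Subspace.dec u v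
    ... | yes v∈u = v , v∈u , λ _ → ≈ᴹ-refl
    ... | no  v∉u = 0ᴹ , Subspace.0-closed u , λ v∈u → contradiction v∈u v∉u

    generators : Subspace → Vector Carrierᴹ n
    generators u i = proj₁ (generator u (List.lookup vectors i))

    span⊆u : ∀ u → span (generators u) ⊆ u
    span⊆u u w (c , w≈) = Subspace.resp u (≈ᴹ-sym w≈)
      (combination-closed u c (generators u) λ i → proj₁ (proj₂ (generator u (List.lookup vectors i))))

    u⊆span : ∀ u → u ⊆ span (generators u)
    u⊆span u w w∈u = Subspace.resp (span (generators u))
      (≈ᴹ-trans (proj₂ (proj₂ (generator u _)) (Subspace.resp u w≈vᵢ w∈u)) (≈ᴹ-sym w≈vᵢ))
      (δ i , ≈ᴹ-sym (combination-δ (generators u) i))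
      where
      i = Any.index (vectors-complete w)
      w≈vᵢ : w ≈ᴹ List.lookup vectors i
      w≈vᵢ = Any.lookup-index (vectors-complete w)

  dim-bounded : ∀ {u n} → dim u ≡ n → n ℕ.≤ List.length vectors
  dim-bounded (v , mkIsBasis _ indep _) = Fin.injective⇒≤ {f = Any.index ∘ vectors-complete ∘ v} λ {i} {j} eq →
    independent⇒injective indep (≈ᴹ-trans (Any.lookup-index (vectors-complete (v i)))
      (≈ᴹ-trans (≈ᴹ-reflexive (≡.cong (List.lookup vectors) eq))
                (≈ᴹ-sym (Any.lookup-index (vectors-complete (v j))))))

  _covers?_ : Decidable₂ _covers_
  v covers? u = u ⊆? v ×-dec map′
    (λ (d , ds) → Fin.toℕ d , ds)
    (λ (d , ds) → let d<1+L = ℕ.s≤s (dim-bounded {u} (proj₁ ds)) in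
      Fin.fromℕ< d<1+L ,
      ≡.subst (λ d → dim u ≡ d × dim v ≡ suc d) (≡.sym (Fin.toℕ-fromℕ< d<1+L)) ds)
    (Fin.any? {n = suc (List.length vectors)} λ d → dim? u (Fin.toℕ d) ×-dec dim? v (suc (Fin.toℕ d)))

  covers-resp : ∀ {α} → (α covers_) Respects _≐_
  covers-resp {_} {β} {γ} β≐γ@(_ , γ⊆β) (β⊆α , d , dimβ , dimα) =
    (λ w → β⊆α w ∘ γ⊆β w) , d , dim-resp {d} {β} {γ} β≐γ dimβ , dimα

  LowerCover : Subspace → Setoid _ _
  LowerCover α = subsetoid subspaceSetoid (α covers_)

  lowerCovers : ∀ α → Enumeration (LowerCover α)
  lowerCovers α = restrict (λ {β} {γ} → covers-resp {α} {β} {γ}) (α covers?_) subspaces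

module Grassmann
  (F : HeytingField f ℓ₁ ℓ₂) {q : ℕ} (size : HasSize F q)
  (𝒱 : VectorSpace F m ℓm) {N : ℕ} (dim𝒱 : LinearAlgebra.HasDim F 𝒱 U N)
  (D : ℕ)
  where

  open FiniteLinearAlgebra F size 𝒱 dim𝒱 public

  X : Setoid (f ⊔ ℓ₁ ⊔ m ⊔ ℓm ⊔ lsuc (f ⊔ ℓm)) (f ⊔ m ⊔ ℓm)
  X = subsetoid subspaceSetoid (dim_≡ D)

  Vertex : Set _
  Vertex = Setoid.Carrier X

  vertices : Enumeration X
  vertices = restrict (λ {u} {v} → dim-resp {D} {u} {v}) (λ u → dim? u D) subspaces

  Adjacent : Vertex → Vertex → Set (f ⊔ ℓ₁ ⊔ m ⊔ ℓm)
  Adjacent (y , _) (z , _) = dim (y ∩ z) ≡ (D ∸ 1)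

  adjacent? : Decidable₂ Adjacent
  adjacent? (y , _) (z , _) = dim? (y ∩ z) (D ∸ 1)

  -- [ℓ] = (q^ℓ - 1)/(q - 1); the division is exact.
  [_] : ℕ → ℕ
  [ ℓ ] = (q ^ ℓ ∸ 1) / (q ∸ 1)
    where instance _ = q-1≢0

  -- The arguments N - D and N - i + 1 are natural numbers for 0 ≤ i ≤ D ≤ N.
  θ : ℕ → ℤ
  θ i = pos (q ℕ.* [ D ] ℕ.* [ N ∸ D ]) ℤ.- pos ([ i ] ℕ.* [ N ∸ i ℕ.+ 1 ])

  -- The vector space K^X, with K any commutative ring of coefficients (e.g. ℂ).
  module Coefficients (K : CommutativeRing k ℓk) where
    open CommutativeRing K
      using (_≈_; _+_; _*_; -_; 0#; 1#; +-rawMonoid; +-commutativeMonoid) renaming (Carrier to 𝕂)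
    open RawMonoidDefs +-rawMonoid using () renaming (_×_ to _times_)

    fromℤ : ℤ → 𝕂
    fromℤ (pos n)  = n times 1#
    fromℤ -[1+ n ] = - (suc n times 1#)

    Vec : Set _
    Vec = Vertex → 𝕂

    Matrix : Set _
    Matrix = Vertex → Vertex → 𝕂

    infix  4 _≈ⱽ_
    infixl 6 _+ⱽ_
    infixr 7 _∙_ _·_
    infix  8 _^∨

    _≈ⱽ_ : Vec → Vec → Set _
    v ≈ⱽ w = ∀ y → v y ≈ w y

    _+ⱽ_ : Vec → Vec → Vec
    (v +ⱽ w) y = v y + w y

    _∙_ : ℤ → Vec → Vec
    (n ∙ v) y = fromℤ n * v y

    ∑ : {S : Setoid a ℓ} → Enumeration S → (Setoid.Carrier S → 𝕂) → 𝕂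
    ∑ E g = List.foldr (λ s → g s +_) 0# (Enumeration.list E)

    ∑ⱽ : {S : Setoid a ℓ} → Enumeration S → (Setoid.Carrier S → Vec) → Vec
    ∑ⱽ E g y = ∑ E λ s → g s y

    _·_ : Matrix → Vec → Vec
    (M · v) y = ∑ vertices λ z → M y z * v z

    A : Matrix
    A y z = if ⌊ adjacent? y z ⌋ then 1# else 0#

    unit : Vertex → Vec
    unit (y , _) (z , _) = if ⌊ y ≐? z ⌋ then 1# else 0#

    Above : Subspace → Setoid _ _
    Above α = subsetoid X (λ y → α ⊆ proj₁ y)

    verticesAbove : ∀ α → Enumeration (Above α)
    verticesAbove α = restrict (λ {y} {z} (y⊆z , _) α⊆y w → y⊆z w ∘ α⊆y w) (λ y → α ⊆? proj₁ y) vertices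

    _^∨ : Subspace → Vec
    α ^∨ = ∑ⱽ (verticesAbove α) (unit ∘ proj₁)

{-# OPTIONS --safe #-}

-- The coordinate at y of A α^∨ is the number of z adjacent to y with α ⊆ z. For v ∉ y the
-- map z ↦ y ∩ z identifies the z through v with hyperplanes of y, so the count reduces to
-- "[ r ] hyperplanes of y pass through a subspace of codimension r". If α ⊆ y, average over
-- the vectors v ∈ z ∖ y; if α ∩ y is a hyperplane of α, take v ∈ α ∖ y; otherwise no such z
-- exists and no β covered by α lies in y. Dimensions are measured by cardinalities
-- throughout: dim u ≡ n amounts to ∣ u ∣ ≡ q ^ n.
module Submission where

open import Defs
open import Algebra.Apartness.Bundles using (HeytingField)
open import Algebra.Bundles using (CommutativeMonoid; CommutativeRing)
open import Algebra.Module.Bundles using (Module)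
import Algebra.Properties.CommutativeSemigroup as CommutativeSemigroupProperties
import Algebra.Properties.Group as GroupProperties
import Algebra.Properties.Semiring.Mult as Multiples
open import Data.Bool.Base using (if_then_else_)
open import Data.Fin.Base using (Fin; zero; suc)
import Data.Integer.Base as ℤ
import Data.Integer.Properties as ℤ
open import Data.List.Base using (List; []; _∷_; foldr; length; map)
open import Data.List.Properties using (length-tabulate; map-cong)
open import Data.List.Relation.Unary.All as All using (All; []; _∷_)
open import Data.List.Relation.Unary.AllPairs using (_∷_)
open import Data.List.Relation.Unary.Any as Any using (Any; here; there)
open import Data.List.Relation.Unary.Unique.Setoid using (Unique)
import Data.List.Relation.Unary.Unique.Setoid.Properties as Unique
open import Data.Nat.Base using (ℕ; zero; suc; NonZero; _+_; _*_; _∸_; _^_; _≤_; _<_; _>_; z≤n; s≤s; >-nonZero; >-nonZero⁻¹)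
open import Data.Nat.DivMod using (_/_; m*n/n≡m)
open import Data.Nat.ListAction using (sum)
import Data.Nat.Properties as ℕ
open import Data.Nat.Tactic.RingSolver using (solve-∀)
open import Data.Product.Base using (∃; ∃-syntax; _×_; _,_; proj₁; proj₂; map₂)
open import Data.Sum.Base using ([_,_]′)
open import Data.Unit.Base using (⊤; tt)
open import Data.Vec.Functional using (Vector; head; tail) renaming (_∷_ to _◂_)
open import Function.Base using (_∘_; id; case_of_)
open import Function.Bundles using (Inverse)
open import Level using (Level; Lift; lift)
open import Relation.Binary.Bundles using (Setoid)
open import Relation.Binary.Definitions using (_Respects_) renaming (Decidable to Decidable₂)
open import Relation.Binary.PropositionalEquality as ≡ using (_≡_; refl; cong; cong₂)
import Relation.Binary.Reasoning.Setoid as SetoidReasoning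
open import Relation.Nullary using (Dec; yes; no; ¬_; contradiction)
open import Relation.Nullary.Decidable using (⌊_⌋; _×-dec_; ¬?; decidable-stable)
open import Relation.Unary using (Pred; Decidable; U)
open import Relation.Unary.Properties using (U?)

-- The obstacle is the form of the data: `dim u ≡ n` merely asserts a basis of length n, [ℓ] is a
-- quotient formed with truncated subtraction, θ is an integer, and K is an arbitrary commutative
-- ring, where distinct integers may coincide and nonzero ones need not cancel. Hence the whole
-- identity is proved in ℕ. Codimension one becomes `q * ∣ H ∣ ≡ ∣ y ∣`, which is decidable and
-- needs no basis; [ℓ] becomes a geometric sum; the term [i][N - i + 1] subtracted in θ moves to the
-- other side; only the finished identity is mapped into K. Each count of pairs yields an equation
-- of products from which a nonzero factor is cancelled, so nothing is ever divided.

private variable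
  a b f k m p p₁ p₂ ℓ ℓ₁ ℓ₂ ℓk ℓm : Level

-- Indicators, counting along lists and double counting

𝟙 : {P : Set p} → Dec P → ℕ
𝟙 P? = if ⌊ P? ⌋ then 1 else 0

𝟙-cong : {P : Set p} {Q : Set p₁} (P? : Dec P) (Q? : Dec Q) → (P → Q) → (Q → P) → 𝟙 P? ≡ 𝟙 Q?
𝟙-cong (yes _)  (yes _)  _   _   = refl
𝟙-cong (no  _)  (no  _)  _   _   = refl
𝟙-cong (yes px) (no ¬qx) p⇒q _   = contradiction (p⇒q px) ¬qx
𝟙-cong (no ¬px) (yes qx) _   q⇒p = contradiction (q⇒p qx) ¬px

𝟙-split : {P : Set p} {Q : Set p₁} (P? : Dec P) (Q? : Dec Q) →
          𝟙 P? ≡ 𝟙 (P? ×-dec Q?) + 𝟙 (P? ×-dec ¬? Q?)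
𝟙-split (yes _) (yes _) = refl
𝟙-split (yes _) (no  _) = refl
𝟙-split (no  _) _       = refl

𝟙-true : {P : Set p} (P? : Dec P) → P → 𝟙 P? ≡ 1
𝟙-true (yes _)  _  = refl
𝟙-true (no ¬px) px = contradiction px ¬px

𝟙-false : {P : Set p} (P? : Dec P) → ¬ P → 𝟙 P? ≡ 0
𝟙-false (yes px) ¬px = contradiction px ¬px
𝟙-false (no _)   _   = refl

module _ {A : Set a} where

  sumOver : List A → (A → ℕ) → ℕ
  sumOver xs g = sum (map g xs)

  sumOver-cong : ∀ xs {g h : A → ℕ} → (∀ x → g x ≡ h x) → sumOver xs g ≡ sumOver xs h
  sumOver-cong xs g≡h = cong sum (map-cong g≡h xs)

  sumOver-+ : ∀ xs (g h : A → ℕ) → sumOver xs (λ x → g x + h x) ≡ sumOver xs g + sumOver xs h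
  sumOver-+ []       g h = refl
  sumOver-+ (x ∷ xs) g h = ≡.trans (cong (g x + h x +_) (sumOver-+ xs g h))
                                   (interchange (g x) (h x) (sumOver xs g) (sumOver xs h))
    where
    interchange : ∀ a b c d → (a + b) + (c + d) ≡ (a + c) + (b + d)
    interchange = solve-∀

  sumOver-* : ∀ xs (g : A → ℕ) n → sumOver xs (λ x → g x * n) ≡ sumOver xs g * n
  sumOver-* []       g n = refl
  sumOver-* (x ∷ xs) g n = ≡.trans (cong (g x * n +_) (sumOver-* xs g n)) (≡.sym (ℕ.*-distribʳ-+ n (g x) _))

  sumOver-0 : ∀ (xs : List A) → sumOver xs (λ _ → 0) ≡ 0
  sumOver-0 []       = refl
  sumOver-0 (x ∷ xs) = sumOver-0 xs

  count : {P : Pred A p} → List A → Decidable P → ℕ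
  count xs P? = sumOver xs (𝟙 ∘ P?)

  count-cong : ∀ xs {P : Pred A p} {Q : Pred A p₁} (P? : Decidable P) (Q? : Decidable Q) →
               (∀ {x} → P x → Q x) → (∀ {x} → Q x → P x) → count xs P? ≡ count xs Q?
  count-cong xs P? Q? p⇒q q⇒p = sumOver-cong xs λ x → 𝟙-cong (P? x) (Q? x) p⇒q q⇒p

  count-split : ∀ xs {P : Pred A p} {Q : Pred A p₁} (P? : Decidable P) (Q? : Decidable Q) →
                count xs P? ≡ count xs (λ x → P? x ×-dec Q? x) + count xs (λ x → P? x ×-dec ¬? (Q? x))
  count-split xs P? Q? = ≡.trans (sumOver-cong xs λ x → 𝟙-split (P? x) (Q? x)) (sumOver-+ xs _ _)

  count-none : ∀ xs {P : Pred A p} (P? : Decidable P) → All (¬_ ∘ P) xs → count xs P? ≡ 0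
  count-none []       P? []           = refl
  count-none (x ∷ xs) P? (¬px ∷ ¬pxs) = cong₂ _+_ (𝟙-false (P? x) ¬px) (count-none xs P? ¬pxs)

  count-all : ∀ xs {P : Pred A p} (P? : Decidable P) → (∀ x → P x) → count xs P? ≡ length xs
  count-all []       P? all = refl
  count-all (x ∷ xs) P? all = cong₂ _+_ (𝟙-true (P? x) (all x)) (count-all xs P? all)

  count-any : ∀ {xs} {P : Pred A p} (P? : Decidable P) → Any P xs → 1 ≤ count xs P?
  count-any {xs = x ∷ xs} P? (here px) with P? x
  ... | yes _  = s≤s z≤n
  ... | no ¬px = contradiction px ¬px
  count-any {xs = x ∷ xs} P? (there any) = ℕ.≤-trans (count-any P? any) (ℕ.m≤n+m _ (𝟙 (P? x)))

-- `R` may mention the proof stored in the pair, but being equivalent to `Q` it depends on the first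
-- component only. This trades the lists of vertices and of lower covers for the list of all
-- subspaces.
count-restrictList : {A : Set a} (xs : List A) {P : Pred A p} (P? : Decidable P)
                     {Q : Pred A p₁} (Q? : Decidable Q) {R : Pred (∃ P) p₂} (R? : Decidable R) →
                     (∀ {x} → R x → Q (proj₁ x)) → (∀ {x} → Q (proj₁ x) → R x) →
                     count (restrictList P? xs) R? ≡ count xs (λ x → P? x ×-dec Q? x)
count-restrictList []       P? Q? R? R⇒Q Q⇒R = refl
count-restrictList (x ∷ xs) P? Q? R? R⇒Q Q⇒R with P? x
... | no  _  = count-restrictList xs P? Q? R? R⇒Q Q⇒R
... | yes px = cong₂ _+_
  (𝟙-cong (R? (x , px)) (yes px ×-dec Q? x) (λ r → px , R⇒Q r) (Q⇒R ∘ proj₂))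
  (count-restrictList xs P? Q? R? R⇒Q Q⇒R)

sumOver-swap : {A : Set a} {B : Set b} (xs : List A) (ys : List B) (g : A → B → ℕ) →
               sumOver xs (λ x → sumOver ys (g x)) ≡ sumOver ys (λ y → sumOver xs λ x → g x y)
sumOver-swap []       ys g = ≡.sym (sumOver-0 ys)
sumOver-swap (x ∷ xs) ys g = ≡.trans (cong (sumOver ys (g x) +_) (sumOver-swap xs ys g))
                                     (≡.sym (sumOver-+ ys (g x) _))

module _ {A : Set a} {B : Set b} {R : A → B → Set p₁} (R? : Decidable₂ R) where

  count-rows : ∀ xs ys {P : Pred A p} (P? : Decidable P) n → (∀ x y → R x y → P x) →
               (∀ x → P x → count ys (R? x) ≡ n) →
               sumOver xs (λ x → count ys (R? x)) ≡ count xs P? * n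
  count-rows xs ys {P} P? n R⇒P rows = ≡.trans (sumOver-cong xs row) (sumOver-* xs _ n)
    where
    row : ∀ x → count ys (R? x) ≡ 𝟙 (P? x) * n
    row x with P? x
    ... | yes px = ≡.trans (rows x px) (≡.sym (ℕ.*-identityˡ n))
    ... | no ¬px = count-none ys (R? x) (All.universal (λ y → ¬px ∘ R⇒P x y) ys)

module _ {A : Set a} {B : Set b} (xs : List A) (ys : List B) {R : A → B → Set p₁} (R? : Decidable₂ R)
         {P : Pred A p} (P? : Decidable P) {Q : Pred B p₂} (Q? : Decidable Q) where

  -- The lists may run over everything: since `R` implies `P` and `Q`, rows and columns outside them
  -- are empty, and m and n need to be known only inside.
  double-count : (∀ x y → R x y → P x × Q y) → ∀ m n →
                 (∀ x → P x → count ys (R? x) ≡ m) → (∀ y → Q y → count xs (λ x → R? x y) ≡ n) →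
                 count xs P? * m ≡ count ys Q? * n
  double-count R⇒P×Q m n rows columns = begin
    count xs P? * m                           ≡⟨ count-rows R? xs ys P? m (λ x y → proj₁ ∘ R⇒P×Q x y) rows ⟨
    sumOver xs (λ x → count ys (R? x))        ≡⟨ sumOver-swap xs ys _ ⟩
    sumOver ys (λ y → count xs λ x → R? x y)  ≡⟨ count-rows (λ y x → R? x y) ys xs Q? n (λ y x → proj₂ ∘ R⇒P×Q x y) columns ⟩
    count ys Q? * n                           ∎
    where open ≡.≡-Reasoning

  count-bijection : (∀ x y → R x y → P x × Q y) →
                    (∀ x → P x → count ys (R? x) ≡ 1) → (∀ y → Q y → count xs (λ x → R? x y) ≡ 1) →
                    count xs P? ≡ count ys Q?
  count-bijection R⇒P×Q rows columns = ≡.trans (≡.sym (ℕ.*-identityʳ _))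
    (≡.trans (double-count R⇒P×Q 1 1 rows columns) (ℕ.*-identityʳ _))

module _ {S : Setoid a ℓ} (E : Enumeration S) where
  open Setoid S using (_≈_) renaming (Carrier to A; sym to ≈-sym; trans to ≈-trans)
  open Enumeration E

  -- Completeness of the enumeration provides an entry equal to x, its uniqueness rules out a second
  -- one.
  count-unique : {P : Pred A p} (P? : Decidable P) → P Respects _≈_ →
                 ∀ x → P x → (∀ {y} → P y → x ≈ y) → count list P? ≡ 1
  count-unique {P = P} P? resp x px x≈ = go (complete x) unique
    where
    go : ∀ {xs} → Any (x ≈_) xs → Unique S xs → count xs P? ≡ 1
    go {y ∷ xs} (here x≈y) (y≉ ∷ _) = cong₂ _+_ (𝟙-true (P? y) (resp x≈y px))
      (count-none xs P? (All.map (λ y≉z pz → y≉z (≈-trans (≈-sym x≈y) (x≈ pz))) y≉))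
    go {y ∷ xs} (there x∈xs) (y≉ ∷ xs!) = cong₂ _+_ (𝟙-false (P? y) ¬py) (go x∈xs xs!)
      where
      ¬py : ¬ P y
      ¬py py = All.lookupWith (λ y≉z x≈z → y≉z (≈-trans (≈-sym (x≈ py)) x≈z)) y≉ x∈xs

  count≢0 : {P : Pred A p} (P? : Decidable P) → P Respects _≈_ → ∃ P → 1 ≤ count list P?
  count≢0 P? resp (x , px) = count-any P? (Any.map (λ x≈y → resp x≈y px) (complete x))

-- Cardinalities of subspaces and their relation to dimension

module Cardinality
  (F : HeytingField f ℓ₁ ℓ₂) {q : ℕ} (size : HasSize F q)
  (𝒱 : VectorSpace F m ℓm) {N : ℕ} (dim𝒱 : LinearAlgebra.HasDim F 𝒱 U N)
  where

  open FiniteLinearAlgebra F size 𝒱 dim𝒱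
  open HeytingField F using (tight; #⇒invertible)
  open Module 𝒱
  private
    module R = CommutativeRing (fieldRing F)
  open R using (_≈_; 0#; 1#; -_) renaming (Carrier to 𝔽; _+_ to _⊕_; _*_ to _⊗_)
  open Enumeration using (list)
  open CommutativeSemigroupProperties (CommutativeMonoid.commutativeSemigroup +ᴹ-commutativeMonoid) using (interchange; x∙yz≈y∙xz)

  -- Tightness only refutes the absence of an inverse; a search through the finitely many scalars
  -- removes the double negation.
  left-inverse : ∀ x → ¬ x ≈ 0# → ∃[ y ] y ⊗ x ≈ 1#
  left-inverse x x≉0 = decidable-stable
    (Search.∃? R.setoid scalars-complete (λ y≈z → R.trans (R.*-congʳ (R.sym y≈z))) (λ y → (y ⊗ x) ≟ 1#))
    λ none → x≉0 (proj₁ (tight x 0#) λ x#0 →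
      let y , y[x-0]≈1 , _ = #⇒invertible x#0 in
      none (y , R.trans (R.*-congˡ (R.sym x-0≈x)) y[x-0]≈1))
    where
    x-0≈x : x R.- 0# ≈ x
    x-0≈x = R.trans (R.+-congˡ (GroupProperties.ε⁻¹≈ε R.+-group)) (R.+-identityʳ x)

  -‿cancelˡ : ∀ c v → (- c) *ₗ v +ᴹ c *ₗ v ≈ᴹ 0ᴹ
  -‿cancelˡ c v = ≈ᴹ-trans (≈ᴹ-sym (*ₗ-distribʳ v (- c) c))
    (≈ᴹ-trans (*ₗ-congʳ (R.-‿inverseˡ c)) (*ₗ-zeroˡ v))

  -‿cancelʳ : ∀ c v → c *ₗ v +ᴹ (- c) *ₗ v ≈ᴹ 0ᴹ
  -‿cancelʳ c v = ≈ᴹ-trans (+ᴹ-comm _ _) (-‿cancelˡ c v)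

  -‿shift : ∀ c {v w x} → w +ᴹ c *ₗ v ≈ᴹ x → w ≈ᴹ (- c) *ₗ v +ᴹ x
  -‿shift c {v} {w} {x} eq = begin
    w                                ≈⟨ +ᴹ-identityʳ w ⟨
    w +ᴹ 0ᴹ                          ≈⟨ +ᴹ-congˡ (-‿cancelˡ c v) ⟨
    w +ᴹ ((- c) *ₗ v +ᴹ c *ₗ v)      ≈⟨ x∙yz≈y∙xz w _ _ ⟩
    (- c) *ₗ v +ᴹ (w +ᴹ c *ₗ v)      ≈⟨ +ᴹ-congˡ eq ⟩
    (- c) *ₗ v +ᴹ x                  ∎
    where open SetoidReasoning ≈ᴹ-setoid

  module _ (u : Subspace) where
    open Subspace u using (resp; +-closed; *-closed)

    +-cancelˡ : ∀ {v w} → contains u v → contains u (v +ᴹ w) → contains u w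
    +-cancelˡ {v} {w} v∈u v+w∈u = resp eq (+-closed (*-closed (- 1#) v∈u) v+w∈u)
      where
      open SetoidReasoning ≈ᴹ-setoid
      eq : (- 1#) *ₗ v +ᴹ (v +ᴹ w) ≈ᴹ w
      eq = begin
        (- 1#) *ₗ v +ᴹ (v +ᴹ w)          ≈⟨ +ᴹ-assoc _ v w ⟨
        (- 1#) *ₗ v +ᴹ v +ᴹ w            ≈⟨ +ᴹ-congʳ (+ᴹ-congˡ (*ₗ-identityˡ v)) ⟨
        (- 1#) *ₗ v +ᴹ 1# *ₗ v +ᴹ w      ≈⟨ +ᴹ-congʳ (-‿cancelˡ 1# v) ⟩
        0ᴹ +ᴹ w                          ≈⟨ +ᴹ-identityˡ w ⟩
        w                                ∎

    +-cancelʳ : ∀ {v w} → contains u w → contains u (v +ᴹ w) → contains u v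
    +-cancelʳ {v} {w} w∈u = +-cancelˡ w∈u ∘ resp (+ᴹ-comm v w)

    *-cancel : ∀ {c v} → ¬ c ≈ 0# → contains u (c *ₗ v) → contains u v
    *-cancel {c} {v} c≉0 cv∈u = let d , dc≈1 = left-inverse c c≉0 in
      resp (≈ᴹ-trans (≈ᴹ-sym (*ₗ-assoc d c v)) (≈ᴹ-trans (*ₗ-congʳ dc≈1) (*ₗ-identityˡ v)))
           (*-closed d cv∈u)

    zero-coefficient : ∀ {c v} → ¬ contains u v → contains u (c *ₗ v) → c ≈ 0#
    zero-coefficient {c} v∉u cv∈u = decidable-stable (c ≟ 0#) λ c≉0 → v∉u (*-cancel c≉0 cv∈u)

  -- u + ⟨v⟩
  extend : Subspace → Carrierᴹ → Subspace
  extend u v = record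
    { contains = λ w → ∃[ c ] contains u (w +ᴹ c *ₗ v)
    ; resp     = λ w≈w′ → map₂ (u.resp (+ᴹ-congʳ w≈w′))
    ; 0-closed = 0# , u.resp (≈ᴹ-sym (≈ᴹ-trans (+ᴹ-identityˡ _) (*ₗ-zeroˡ v))) u.0-closed
    ; +-closed = λ (c , p) (d , q) → c ⊕ d ,
        u.resp (≈ᴹ-trans (interchange _ _ _ _) (+ᴹ-congˡ (≈ᴹ-sym (*ₗ-distribʳ v c d)))) (u.+-closed p q)
    ; *-closed = λ r (c , p) → r ⊗ c ,
        u.resp (≈ᴹ-trans (*ₗ-distribˡ r _ _) (+ᴹ-congˡ (≈ᴹ-sym (*ₗ-assoc r c v)))) (u.*-closed r p)
    ; dec      = λ w → Search.∃? R.setoid scalars-complete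
        (λ c≈d → u.resp (+ᴹ-congˡ (*ₗ-congʳ c≈d))) (λ c → u.dec (w +ᴹ c *ₗ v))
    }
    where module u = Subspace u

  module _ (u : Subspace) (v : Carrierᴹ) where
    private module u = Subspace u

    ⊆-extend : u ⊆ extend u v
    ⊆-extend w w∈u = 0# , u.resp (≈ᴹ-sym (≈ᴹ-trans (+ᴹ-congˡ (*ₗ-zeroˡ v)) (+ᴹ-identityʳ w))) w∈u

    ∈-extend : contains (extend u v) v
    ∈-extend = - 1# , u.resp
      (≈ᴹ-sym (≈ᴹ-trans (+ᴹ-congʳ (≈ᴹ-sym (*ₗ-identityˡ v))) (-‿cancelʳ 1# v))) u.0-closed

    extend-⊆ : ∀ {z} → u ⊆ z → contains z v → extend u v ⊆ z
    extend-⊆ {z} u⊆z v∈z w (c , w+cv∈u) =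
      +-cancelʳ z (Subspace.*-closed z c v∈z) (u⊆z _ w+cv∈u)

    -- A case of the modular law, (u + ⟨v⟩) ∩ y = u: for w in y the term c v lies in y too, and v ∉
    -- y forces c = 0.
    extend-∩ : ∀ {y} → u ⊆ y → ¬ contains y v → ∀ {w} → contains (extend u v) w → contains y w → contains u w
    extend-∩ {y} u⊆y v∉y {w} (c , w+cv∈u) w∈y = u.resp
      (≈ᴹ-trans (+ᴹ-congˡ (≈ᴹ-trans (*ₗ-congʳ c≈0) (*ₗ-zeroˡ v))) (+ᴹ-identityʳ w)) w+cv∈u
      where
      c≈0 : c ≈ 0#
      c≈0 = zero-coefficient y v∉y (+-cancelˡ y w∈y (u⊆y _ w+cv∈u))

  -- `vectors` is only known to be complete; counting also requires that no vector is repeated.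
  allVectors : Enumeration ≈ᴹ-setoid
  allVectors = dedup (record { isDecEquivalence = record
    { isEquivalence = Setoid.isEquivalence ≈ᴹ-setoid ; _≟_ = _≟ᴹ_ } }) vectors-complete

  allScalars : Enumeration R.setoid
  allScalars = record
    { list     = scalars
    ; complete = scalars-complete
    ; unique   = Unique.tabulate⁺ R.setoid λ {i} {j} eq →
        ≡.trans (≡.sym (Inverse.strictlyInverseˡ size i)) (≡.trans (Inverse.to-cong size eq) (Inverse.strictlyInverseˡ size j))
    }

  #vectors : {P : Pred Carrierᴹ p} → Decidable P → ℕ
  #vectors = count (list allVectors)

  ∣_∣ : Subspace → ℕ
  ∣ u ∣ = #vectors (Subspace.dec u)

  ∣∣-resp : ∀ {u v} → u ≐ v → ∣ u ∣ ≡ ∣ v ∣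
  ∣∣-resp {u} {v} (u⊆v , v⊆u) = count-cong (list allVectors) (Subspace.dec u) (Subspace.dec v) (u⊆v _) (v⊆u _)

  ∣∣-split : ∀ {u v} → u ⊆ v → ∣ v ∣ ≡ ∣ u ∣ + #vectors (λ w → Subspace.dec v w ×-dec ¬? (Subspace.dec u w))
  ∣∣-split {u} {v} u⊆v = ≡.trans (count-split (list allVectors) (Subspace.dec v) (Subspace.dec u))
    (cong (_+ #vectors (λ w → Subspace.dec v w ×-dec ¬? (Subspace.dec u w)))
      (count-cong (list allVectors) (λ w → Subspace.dec v w ×-dec Subspace.dec u w) (Subspace.dec u)
      proj₂ λ w∈u → u⊆v _ w∈u , w∈u))

  ∣∣-mono : ∀ {u v} → u ⊆ v → ∣ u ∣ ≤ ∣ v ∣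
  ∣∣-mono {u} {v} u⊆v = ≡.subst (∣ u ∣ ≤_) (≡.sym (∣∣-split {u} {v} u⊆v)) (ℕ.m≤m+n _ _)

  1≤∣∣ : ∀ u → 1 ≤ ∣ u ∣
  1≤∣∣ u = count≢0 allVectors (Subspace.dec u) (Subspace.resp u) (0ᴹ , Subspace.0-closed u)

  -- A vector of v outside u would make the second summand of `∣∣-split` positive. Equality of
  -- subspaces is obtained from this instead of from dimension theory.
  ⊆⇒⊇ : ∀ {u v} → u ⊆ v → ∣ u ∣ ≡ ∣ v ∣ → v ⊆ u
  ⊆⇒⊇ {u} {v} u⊆v eq w w∈v = decidable-stable (u.dec w) λ w∉u →
    ℕ.<-irrefl (ℕ.+-cancelˡ-≡ _ _ _ (≡.trans (ℕ.+-identityʳ _) (≡.trans eq (∣∣-split {u} {v} u⊆v))))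
      (count≢0 allVectors (λ w → v.dec w ×-dec ¬? (u.dec w))
      (λ x≈y (x∈v , x∉u) → v.resp x≈y x∈v , λ y∈u → x∉u (u.resp (≈ᴹ-sym x≈y) y∈u)) (w , w∈v , w∉u))
    where
    module u = Subspace u
    module v = Subspace v

  -- Membership is decidable and the vectors can be searched, so a failed inclusion yields an actual
  -- witness.
  ⊈⇒∃ : ∀ {u v} → ¬ u ⊆ v → ∃[ w ] (contains u w × ¬ contains v w)
  ⊈⇒∃ {u} {v} u⊈v = decidable-stable
    (Search.∃? ≈ᴹ-setoid vectors-complete
      (λ x≈y (x∈u , x∉v) → u.resp x≈y x∈u , λ y∈v → x∉v (v.resp (≈ᴹ-sym x≈y) y∈v))
      (λ w → u.dec w ×-dec ¬? (v.dec w)))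
    λ none → u⊈v λ w w∈u → decidable-stable (v.dec w) λ w∉v → none (w , w∈u , w∉v)
    where
    module u = Subspace u
    module v = Subspace v

  ∣∣-translate : ∀ u t → #vectors (λ w → Subspace.dec u (w +ᴹ t)) ≡ ∣ u ∣
  ∣∣-translate u t = count-bijection (list allVectors) (list allVectors)
    (λ w w′ → (w +ᴹ t) ≟ᴹ w′ ×-dec dec w′) (λ w → dec (w +ᴹ t)) dec
    (λ w w′ (w+t≈w′ , w′∈u) → resp (≈ᴹ-sym w+t≈w′) w′∈u , w′∈u)
    (λ w w+t∈u → count-unique allVectors (λ w′ → (w +ᴹ t) ≟ᴹ w′ ×-dec dec w′)
      (λ x≈y (eq , x∈u) → ≈ᴹ-trans eq x≈y , resp x≈y x∈u) (w +ᴹ t) (≈ᴹ-refl , w+t∈u) proj₁)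
    (λ w′ w′∈u → count-unique allVectors (λ w → (w +ᴹ t) ≟ᴹ w′ ×-dec dec w′)
      (λ x≈y (eq , w′∈u) → ≈ᴹ-trans (+ᴹ-congʳ (≈ᴹ-sym x≈y)) eq , w′∈u) (w′ +ᴹ (-ᴹ t))
      (GroupProperties.//-rightDividesˡ +ᴹ-group t w′ , w′∈u)
      (λ {y} (eq , _) → ≈ᴹ-trans (+ᴹ-congʳ (≈ᴹ-sym eq)) (GroupProperties.//-rightDividesʳ +ᴹ-group t y)))
    where open Subspace u using (dec; resp)

  -- Count the pairs (w , c) with w + c v in u. Two coefficients for one w would put a multiple of v
  -- in u, so c is unique; each of the q scalars c contributes a translate of u.
  ∣extend∣ : ∀ u v → ¬ contains u v → ∣ extend u v ∣ ≡ q * ∣ u ∣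
  ∣extend∣ u v v∉u = begin
    ∣ extend u v ∣             ≡⟨ ℕ.*-identityʳ _ ⟨
    ∣ extend u v ∣ * 1         ≡⟨ double-count (list allVectors) scalars
                                    (λ w c → dec (w +ᴹ c *ₗ v)) (Subspace.dec (extend u v)) U?
                                    (λ w c p → (c , p) , tt) 1 ∣ u ∣ one-coefficient (λ c _ → ∣∣-translate u (c *ₗ v)) ⟩
    count scalars U? * ∣ u ∣   ≡⟨ cong (_* ∣ u ∣) (≡.trans (count-all scalars U? (λ _ → tt)) (length-tabulate (Inverse.from size))) ⟩
    q * ∣ u ∣                  ∎
    where
    open ≡.≡-Reasoning
    open Subspace u using (dec; resp)

    one-coefficient : ∀ w → contains (extend u v) w → count scalars (λ c → dec (w +ᴹ c *ₗ v)) ≡ 1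
    one-coefficient w (c , w+cv∈u) = count-unique allScalars (λ c → dec (w +ᴹ c *ₗ v))
      (λ c≈d → resp (+ᴹ-congˡ (*ₗ-congʳ c≈d))) c w+cv∈u
      λ {d} w+dv∈u → R.sym (GroupProperties.x∙y⁻¹≈ε⇒x≈y R.+-group d c (zero-coefficient u v∉u
        (+-cancelˡ u w+cv∈u (resp (eq d) w+dv∈u))))
      where
      eq : ∀ d → w +ᴹ d *ₗ v ≈ᴹ w +ᴹ c *ₗ v +ᴹ (d R.- c) *ₗ v
      eq d = ≈ᴹ-trans (+ᴹ-congˡ (*ₗ-cong (R.sym (R.trans (R.+-comm c _) (GroupProperties.//-rightDividesˡ R.+-group c d))) ≈ᴹ-refl))
        (≈ᴹ-trans (+ᴹ-congˡ (*ₗ-distribʳ v c (d R.- c))) (≈ᴹ-sym (+ᴹ-assoc w _ _)))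

  -- The head coefficient changes sign because `extend` tests whether w + c v lies in the smaller
  -- space.
  span≐extend : ∀ {n} (v : Vector Carrierᴹ (suc n)) → span v ≐ extend (span (tail v)) (head v)
  span≐extend v =
    (λ w (c , w≈) → - head c , tail c , (begin
      w +ᴹ (- head c) *ₗ head v            ≈⟨ +ᴹ-comm w _ ⟩
      (- head c) *ₗ head v +ᴹ w            ≈⟨ +ᴹ-congˡ w≈ ⟩
      (- head c) *ₗ head v +ᴹ (head c *ₗ head v +ᴹ combination (tail c) (tail v)) ≈⟨ +ᴹ-assoc _ _ _ ⟨
      (- head c) *ₗ head v +ᴹ head c *ₗ head v +ᴹ combination (tail c) (tail v)   ≈⟨ +ᴹ-congʳ (-‿cancelˡ (head c) (head v)) ⟩
      0ᴹ +ᴹ combination (tail c) (tail v)  ≈⟨ +ᴹ-identityˡ _ ⟩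
      combination (tail c) (tail v)        ∎)) ,
    (λ w (c , d , w+cv≈) → ((- c) ◂ d) , -‿shift c w+cv≈)
    where open SetoidReasoning ≈ᴹ-setoid

  independent-tail : ∀ {n} (v : Vector Carrierᴹ (suc n)) → LinearlyIndependent v → LinearlyIndependent (tail v)
  independent-tail v indep c cv≈0 i = indep (0# ◂ c)
    (≈ᴹ-trans (+ᴹ-cong (*ₗ-zeroˡ (head v)) cv≈0) (+ᴹ-identityˡ 0ᴹ)) (suc i)

  independent-head : ∀ {n} (v : Vector Carrierᴹ (suc n)) → LinearlyIndependent v → ¬ InSpan (tail v) (head v)
  independent-head v indep (c , v₀≈) = 1≉0 (indep (1# ◂ λ i → (- 1#) ⊗ c i) (begin
    1# *ₗ head v +ᴹ combination (λ i → (- 1#) ⊗ c i) (tail v)  ≈⟨ +ᴹ-congˡ (combination-* (- 1#) c (tail v)) ⟨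
    1# *ₗ head v +ᴹ (- 1#) *ₗ combination c (tail v)          ≈⟨ +ᴹ-congˡ (*ₗ-congˡ v₀≈) ⟨
    1# *ₗ head v +ᴹ (- 1#) *ₗ head v                          ≈⟨ -‿cancelʳ 1# (head v) ⟩
    0ᴹ                                                        ∎) zero)
    where open SetoidReasoning ≈ᴹ-setoid

  independent-◂ : ∀ {n} {v : Vector Carrierᴹ n} {w} → LinearlyIndependent v → ¬ InSpan v w → LinearlyIndependent (w ◂ v)
  independent-◂ {v = v} {w} indep w∉ c cv≈0 = λ where
      zero    → c₀≈0
      (suc i) → indep (tail c) (≈ᴹ-trans
        (≈ᴹ-sym (≈ᴹ-trans (+ᴹ-congʳ (≈ᴹ-trans (*ₗ-congʳ c₀≈0) (*ₗ-zeroˡ w))) (+ᴹ-identityˡ _))) cv≈0) i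
    where
    c₀≈0 : head c ≈ 0#
    c₀≈0 = zero-coefficient (span v) w∉ (+-cancelʳ (span v) (tail c , ≈ᴹ-refl)
      (Subspace.resp (span v) (≈ᴹ-sym cv≈0) (Subspace.0-closed (span v))))

  ∣span∣ : ∀ {n} (v : Vector Carrierᴹ n) → LinearlyIndependent v → ∣ span v ∣ ≡ q ^ n
  ∣span∣ {zero}  v indep = count-unique allVectors (inSpan? v) (Subspace.resp (span v)) 0ᴹ
    (Subspace.0-closed (span v)) (≈ᴹ-sym ∘ proj₂)
  ∣span∣ {suc n} v indep = ≡.trans (∣∣-resp {span v} {extend (span (tail v)) (head v)} (span≐extend v))
    (≡.trans (∣extend∣ (span (tail v)) (head v) (independent-head v indep))
      (cong (q *_) (∣span∣ (tail v) (independent-tail v indep))))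

  dim⇒∣∣ : ∀ u {n} → dim u ≡ n → ∣ u ∣ ≡ q ^ n
  dim⇒∣∣ u (v , mkIsBasis v∈u indep spans) = ≡.trans
    (∣∣-resp {u} {span v} (spans , λ w (c , w≈) → Subspace.resp u (≈ᴹ-sym w≈) (combination-closed u c v v∈u)))
    (∣span∣ v indep)

  q≡1+p : q ≡ suc (q ∸ 1)
  q≡1+p = go q q-1≢0
    where
    go : ∀ n → NonZero (n ∸ 1) → n ≡ suc (n ∸ 1)
    go (suc n) _ = refl

  1<q : 1 < q
  1<q = ≡.subst (1 <_) (≡.sym q≡1+p) (s≤s (>-nonZero⁻¹ (q ∸ 1) {{q-1≢0}}))

  -- A basis is grown greedily: j < n independent vectors of u span only q ^ j vectors, so u has a
  -- vector outside their span. After n steps the cardinalities agree and the family spans u.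
  ∣∣⇒dim : ∀ u {n} → ∣ u ∣ ≡ q ^ n → dim u ≡ n
  ∣∣⇒dim u {n} ∣u∣≡ = let v , v∈u , indep = independent-family n ℕ.≤-refl in
    v , mkIsBasis v∈u indep (⊆⇒⊇ {span v} {u} (span⊆u v∈u) (≡.trans (∣span∣ v indep) (≡.sym ∣u∣≡)))
    where
    span⊆u : ∀ {j} {v : Vector Carrierᴹ j} → (∀ i → contains u (v i)) → span v ⊆ u
    span⊆u {v = v} v∈u w (c , w≈) = Subspace.resp u (≈ᴹ-sym w≈) (combination-closed u c v v∈u)

    independent-family : ∀ j → j ≤ n → ∃[ v ] ((∀ (i : Fin j) → contains u (v i)) × LinearlyIndependent v)
    independent-family zero    _   = (λ ()) , (λ ()) , λ _ _ ()
    independent-family (suc j) j<n =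
      let v , v∈u , indep = independent-family j (ℕ.<⇒≤ j<n)
          w , w∈u , w∉ = ⊈⇒∃ {u} {span v} λ u⊆span → ℕ.<-irrefl refl (ℕ.<-≤-trans
            (ℕ.^-monoʳ-< q 1<q j<n)
            (≡.subst₂ _≤_ ∣u∣≡ (∣span∣ v indep) (∣∣-mono {u} {span v} u⊆span)))
      in (w ◂ v) , (λ { zero → w∈u ; (suc i) → v∈u i }) , independent-◂ indep w∉

-- The q-integers [ℓ] as sums 1 + q + ... + q^(ℓ-1)

geometric : ℕ → ℕ → ℕ
geometric q zero    = 0
geometric q (suc ℓ) = geometric q ℓ + q ^ ℓ

-- The formula q^ℓ - 1 = (q - 1)[ℓ] without subtraction, with p standing for q - 1.
^-geometric : ∀ {q p} → q ≡ suc p → ∀ ℓ → q ^ ℓ ≡ 1 + p * geometric q ℓ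
^-geometric {q} {p} q≡1+p zero    = cong suc (≡.sym (ℕ.*-zeroʳ p))
^-geometric {q} {p} q≡1+p (suc ℓ) = begin
  q * q ^ ℓ                              ≡⟨ cong (_* q ^ ℓ) q≡1+p ⟩
  q ^ ℓ + p * q ^ ℓ                      ≡⟨ cong (_+ p * q ^ ℓ) (^-geometric q≡1+p ℓ) ⟩
  1 + p * geometric q ℓ + p * q ^ ℓ      ≡⟨ cong suc (ℕ.*-distribˡ-+ p (geometric q ℓ) (q ^ ℓ)) ⟨
  1 + p * (geometric q ℓ + q ^ ℓ)        ∎
  where open ≡.≡-Reasoning

geometric-+ : ∀ q m n → geometric q (m + n) ≡ geometric q m + q ^ m * geometric q n
geometric-+ q m zero    = begin
  geometric q (m + 0)         ≡⟨ cong (geometric q) (ℕ.+-identityʳ m) ⟩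
  geometric q m               ≡⟨ ℕ.+-identityʳ _ ⟨
  geometric q m + 0           ≡⟨ cong (geometric q m +_) (ℕ.*-zeroʳ (q ^ m)) ⟨
  geometric q m + q ^ m * 0   ∎
  where open ≡.≡-Reasoning
geometric-+ q m (suc n) = begin
  geometric q (m + suc n)                                     ≡⟨ cong (geometric q) (ℕ.+-suc m n) ⟩
  geometric q (m + n) + q ^ (m + n)                           ≡⟨ cong₂ _+_ (geometric-+ q m n) (ℕ.^-distribˡ-+-* q m n) ⟩
  geometric q m + q ^ m * geometric q n + q ^ m * q ^ n       ≡⟨ ring (geometric q m) (q ^ m) (geometric q n) (q ^ n) ⟩
  geometric q m + q ^ m * (geometric q n + q ^ n)             ∎
  where
  open ≡.≡-Reasoning
  ring : ∀ a b c d → a + b * c + b * d ≡ a + b * (c + d)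
  ring = solve-∀

-- The number of hyperplanes through a given subspace

module Hyperplanes
  (F : HeytingField f ℓ₁ ℓ₂) {q : ℕ} (size : HasSize F q)
  (𝒱 : VectorSpace F m ℓm) {N : ℕ} (dim𝒱 : LinearAlgebra.HasDim F 𝒱 U N)
  where

  open FiniteLinearAlgebra F size 𝒱 dim𝒱
  open Cardinality F size 𝒱 dim𝒱
  open Module 𝒱 using (Carrierᴹ)
  open Enumeration using (list)

  instance
    q∸1-nonZero : NonZero (q ∸ 1)
    q∸1-nonZero = q-1≢0

    q-nonZero : NonZero q
    q-nonZero = >-nonZero (ℕ.<⇒≤ 1<q)

  ∣∣-nonZero : ∀ u → NonZero ∣ u ∣
  ∣∣-nonZero u = >-nonZero (1≤∣∣ u)

  ⊆-trans : ∀ {u v w} → u ⊆ v → v ⊆ w → u ⊆ w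
  ⊆-trans u⊆v v⊆w x = v⊆w x ∘ u⊆v x

  #subspaces : {P : Pred Subspace p} → Decidable P → ℕ
  #subspaces = count (list subspaces)

  Hyperplane : Subspace → Subspace → Subspace → Set _
  Hyperplane γ y H = γ ⊆ H × H ⊆ y × q * ∣ H ∣ ≡ ∣ y ∣

  hyperplane? : ∀ γ y → Decidable (Hyperplane γ y)
  hyperplane? γ y H = γ ⊆? H ×-dec H ⊆? y ×-dec q * ∣ H ∣ ℕ.≟ ∣ y ∣

  Hyperplane-resp : ∀ γ y → Hyperplane γ y Respects _≐_
  Hyperplane-resp γ y {H} {H′} H≐H′@(H⊆H′ , H′⊆H) (γ⊆H , H⊆y , qH≡y) =
    ⊆-trans {γ} {H} {H′} γ⊆H H⊆H′ , ⊆-trans {H′} {H} {y} H′⊆H H⊆y ,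
    ≡.trans (cong (q *_) (≡.sym (∣∣-resp {H} {H′} H≐H′))) qH≡y

  -- With a and b the sizes of a hyperplane and of its ambient space, c counts the vectors off the
  -- hyperplane. `^*-splits` is the analogue for codimension r.
  q*-splits : ∀ {a b c} → q * a ≡ b → b ≡ a + c → c ≡ (q ∸ 1) * a
  q*-splits {a} {b} {c} qa≡b b≡a+c = ℕ.+-cancelˡ-≡ a c _ (≡.trans (≡.sym b≡a+c)
    (≡.trans (≡.sym qa≡b) (cong (_* a) q≡1+p)))

  ^*-splits : ∀ r {a b c} → b ≡ q ^ r * a → b ≡ a + c → c ≡ (q ∸ 1) * geometric q r * a
  ^*-splits r {a} {b} {c} b≡ b≡a+c = ℕ.+-cancelˡ-≡ a c _ (≡.trans (≡.sym b≡a+c)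
    (≡.trans b≡ (cong (_* a) (^-geometric q≡1+p r))))

  private
    -- Here R = [r], Q = q^r, g is the size of γ, p = q - 1, h counts all hyperplanes through γ and
    -- n those avoiding a fixed vector. Removing p g leaves (R + n) Q = (R + Q) n, hence R Q = R n,
    -- and R ≠ 0 gives n = Q.
    cancel-step : ∀ R Q g p h n .{{_ : NonZero R}} .{{_ : NonZero g}} .{{_ : NonZero p}} →
                  R + n ≡ h → h * (p * (Q * g)) ≡ p * (R + Q) * g * n → h ≡ R + Q
    cancel-step R Q g p h n refl eq = cong (R +_) (≡.sym (ℕ.*-cancelˡ-≡ Q n R
      (ℕ.+-cancelʳ-≡ (n * Q) (R * Q) (R * n) (ℕ.*-cancelˡ-≡ _ _ (p * g) {{ℕ.m*n≢0 p g}}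
        (≡.trans (ringˡ R Q g p n) (≡.trans eq (ringʳ R Q g p n)))))))
      where
      ringˡ : ∀ R Q g p n → p * g * (R * Q + n * Q) ≡ (R + n) * (p * (Q * g))
      ringˡ = solve-∀
      ringʳ : ∀ R Q g p n → p * (R + Q) * g * n ≡ p * g * (R * n + n * Q)
      ringʳ = solve-∀

  -- γ and y stay quantified because the induction applies the count for r to `extend γ v` in place
  -- of γ.
  HyperplaneCount : ℕ → Set _
  HyperplaneCount r = ∀ γ y → γ ⊆ y → ∣ y ∣ ≡ q ^ r * ∣ γ ∣ → #subspaces (hyperplane? γ y) ≡ geometric q r

  -- Count the pairs (H , v) with v ∈ y ∖ H: for each v ∈ y ∖ γ the hyperplanes through γ
  -- that contain v are the ones through γ + ⟨v⟩. For r = 0 the resulting equation is void.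
  #hyperplanes-step : ∀ r .{{_ : NonZero r}} → HyperplaneCount r → HyperplaneCount (suc r)
  #hyperplanes-step r@(suc r′) hyperplanes-r γ y γ⊆y ∣y∣≡ =
    cancel-step (geometric q r) (q ^ r) ∣ γ ∣ (q ∸ 1) _ avoiding {{geometric-nonZero}} {{∣∣-nonZero γ}} (through+avoiding v₀ v₀∈y v₀∉γ)
      (≡.trans
        (double-count (list subspaces) (list allVectors)
          (λ H v → hyperplane? γ y H ×-dec dec v ×-dec ¬? (Subspace.dec H v)) (hyperplane? γ y)
          (λ v → dec v ×-dec ¬? (Subspace.dec γ v))
          (λ H v (hyp@(γ⊆H , _) , v∈y , v∉H) → hyp , v∈y , v∉H ∘ γ⊆H v)
          ((q ∸ 1) * (q ^ r * ∣ γ ∣)) avoiding vectors-off-H hyperplanes-off-v)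
        (cong (_* avoiding) (^*-splits (suc r) ∣y∣≡ (∣∣-split {γ} {y} γ⊆y))))
    where
    open Subspace y using (dec)

    geometric-nonZero : NonZero (geometric q r)
    geometric-nonZero = >-nonZero (ℕ.≤-trans (ℕ.m^n>0 q r′) (ℕ.m≤n+m _ (geometric q r′)))

    y⊈γ : ¬ y ⊆ γ
    y⊈γ y⊆γ = ℕ.<-irrefl refl (ℕ.<-≤-trans
      (≡.subst (∣ γ ∣ <_) (ℕ.*-comm ∣ γ ∣ (q ^ suc r))
        (ℕ.m<m*n ∣ γ ∣ (q ^ suc r) {{∣∣-nonZero γ}} (ℕ.^-monoʳ-< q 1<q {0} {suc r} (s≤s z≤n))))
      (≡.subst (_≤ ∣ γ ∣) ∣y∣≡ (∣∣-mono {y} {γ} y⊆γ)))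

    v₀ : Carrierᴹ
    v₀ = proj₁ (⊈⇒∃ {y} {γ} y⊈γ)
    v₀∈y : contains y v₀
    v₀∈y = proj₁ (proj₂ (⊈⇒∃ {y} {γ} y⊈γ))
    v₀∉γ : ¬ contains γ v₀
    v₀∉γ = proj₂ (proj₂ (⊈⇒∃ {y} {γ} y⊈γ))

    #avoiding : Carrierᴹ → ℕ
    #avoiding v = #subspaces (λ H → hyperplane? γ y H ×-dec ¬? (Subspace.dec H v))

    -- By `through+avoiding` the value `#avoiding v` is the same for every v in y outside γ; its
    -- value at v₀ serves as the common column size.
    avoiding : ℕ
    avoiding = #avoiding v₀

    through+avoiding : ∀ v → contains y v → ¬ contains γ v →
                       geometric q r + #avoiding v ≡ #subspaces (hyperplane? γ y)
    through+avoiding v v∈y v∉γ = ≡.trans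
      (cong (_+ #avoiding v) (≡.trans
        (≡.sym (hyperplanes-r (extend γ v) y (extend-⊆ γ v {y} γ⊆y v∈y)
          (≡.trans ∣y∣≡ (≡.trans (ring q (q ^ r) ∣ γ ∣) (cong (q ^ r *_) (≡.sym (∣extend∣ γ v v∉γ)))))))
        (count-cong (list subspaces) (hyperplane? (extend γ v) y) (λ H → hyperplane? γ y H ×-dec Subspace.dec H v)
          (λ {H} (γv⊆H , H⊆y , qH≡y) →
            (⊆-trans {γ} {extend γ v} {H} (⊆-extend γ v) γv⊆H , H⊆y , qH≡y) , γv⊆H v (∈-extend γ v))
          (λ {H} ((γ⊆H , H⊆y , qH≡y) , v∈H) → extend-⊆ γ v {H} γ⊆H v∈H , H⊆y , qH≡y))))
      (≡.sym (count-split (list subspaces) (hyperplane? γ y) (λ H → Subspace.dec H v)))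
      where
      ring : ∀ q Q g → q * Q * g ≡ Q * (q * g)
      ring = solve-∀

    vectors-off-H : ∀ H → Hyperplane γ y H →
      #vectors (λ v → hyperplane? γ y H ×-dec dec v ×-dec ¬? (Subspace.dec H v)) ≡ (q ∸ 1) * (q ^ r * ∣ γ ∣)
    vectors-off-H H hyp@(γ⊆H , H⊆y , qH≡y) = ≡.trans
      (count-cong (list allVectors) (λ v → hyperplane? γ y H ×-dec dec v ×-dec ¬? (Subspace.dec H v))
        (λ v → dec v ×-dec ¬? (Subspace.dec H v)) proj₂ (hyp ,_))
      (≡.trans (q*-splits qH≡y (∣∣-split {H} {y} H⊆y))
        (cong ((q ∸ 1) *_) (ℕ.*-cancelˡ-≡ _ _ q
          (≡.trans qH≡y (≡.trans ∣y∣≡ (ℕ.*-assoc q (q ^ r) ∣ γ ∣))))))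

    hyperplanes-off-v : ∀ v → contains y v × ¬ contains γ v →
      #subspaces (λ H → hyperplane? γ y H ×-dec dec v ×-dec ¬? (Subspace.dec H v)) ≡ avoiding
    hyperplanes-off-v v (v∈y , v∉γ) = ≡.trans
      (count-cong (list subspaces) (λ H → hyperplane? γ y H ×-dec dec v ×-dec ¬? (Subspace.dec H v))
        (λ H → hyperplane? γ y H ×-dec ¬? (Subspace.dec H v))
        (λ (hyp , _ , v∉H) → hyp , v∉H) (λ (hyp , v∉H) → hyp , v∈y , v∉H))
      (ℕ.+-cancelˡ-≡ (geometric q r) _ _
        (≡.trans (through+avoiding v v∈y v∉γ) (≡.sym (through+avoiding v₀ v₀∈y v₀∉γ))))

  -- Two base cases, since the step cancels the factor [r]. For r = 0 a hyperplane of y is too small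
  -- to contain γ; for r = 1 it must be γ itself.
  #hyperplanes : ∀ r → HyperplaneCount r
  #hyperplanes zero γ y γ⊆y ∣y∣≡ = count-none (list subspaces) (hyperplane? γ y) (All.universal none (list subspaces))
    where
    none : ∀ H → ¬ Hyperplane γ y H
    none H (γ⊆H , H⊆y , qH≡y) = ℕ.<-irrefl refl (ℕ.<-≤-trans
      (≡.subst (∣ H ∣ <_) (ℕ.*-comm ∣ H ∣ q) (ℕ.m<m*n ∣ H ∣ q {{∣∣-nonZero H}} 1<q))
      (≡.subst (_≤ ∣ H ∣) (≡.trans (≡.sym (ℕ.*-identityˡ ∣ γ ∣)) (≡.trans (≡.sym ∣y∣≡) (≡.sym qH≡y))) (∣∣-mono {γ} {H} γ⊆H)))
  #hyperplanes (suc zero) γ y γ⊆y ∣y∣≡ = count-unique subspaces (hyperplane? γ y)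
    (λ {H} {H′} → Hyperplane-resp γ y {H} {H′}) γ ((λ _ → id) , γ⊆y , q∣γ∣≡)
    λ {H} (γ⊆H , H⊆y , qH≡y) → γ⊆H , ⊆⇒⊇ {γ} {H} γ⊆H (ℕ.*-cancelˡ-≡ _ _ q (≡.trans q∣γ∣≡ (≡.sym qH≡y)))
    where
    q∣γ∣≡ : q * ∣ γ ∣ ≡ ∣ y ∣
    q∣γ∣≡ = ≡.sym (≡.trans ∣y∣≡ (cong (_* ∣ γ ∣) (ℕ.*-identityʳ q)))
  #hyperplanes (suc (suc r)) γ y γ⊆y ∣y∣≡ = #hyperplanes-step (suc r) (#hyperplanes (suc r)) γ y γ⊆y ∣y∣≡

-- Neighbours of y above a subspace, and lower covers inside y

module Neighbours
  (F : HeytingField f ℓ₁ ℓ₂) {q : ℕ} (size : HasSize F q)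
  (𝒱 : VectorSpace F m ℓm) {N : ℕ} (dim𝒱 : LinearAlgebra.HasDim F 𝒱 U N)
  where

  open FiniteLinearAlgebra F size 𝒱 dim𝒱
  open Cardinality F size 𝒱 dim𝒱
  open Hyperplanes F size 𝒱 dim𝒱
  open Enumeration using (list)
  open Setoid subspaceSetoid using () renaming (trans to ≐-trans)

  whole : Subspace
  whole = record
    { contains = λ _ → Lift _ ⊤
    ; resp     = λ _ _ → lift tt
    ; 0-closed = lift tt
    ; +-closed = λ _ _ → lift tt
    ; *-closed = λ _ _ → lift tt
    ; dec      = λ _ → yes (lift tt)
    }

  ∣whole∣ : ∣ whole ∣ ≡ q ^ N
  ∣whole∣ = let e , mkIsBasis _ indep spans = dim𝒱 in
    dim⇒∣∣ whole (e , mkIsBasis (λ _ → lift tt) indep λ w _ → spans w tt)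

  -- Taken as γ, the zero space turns the count of hyperplanes through γ into the count of all
  -- hyperplanes.
  trivial : Subspace
  trivial = span {0} λ ()

  trivial-⊆ : ∀ u → trivial ⊆ u
  trivial-⊆ u w (_ , w≈0) = Subspace.resp u (Module.≈ᴹ-sym 𝒱 w≈0) (Subspace.0-closed u)

  ∣trivial∣ : ∣ trivial ∣ ≡ 1
  ∣trivial∣ = ∣span∣ {0} (λ ()) λ _ _ ()

  ∩-congˡ : ∀ y {u v} → u ≐ v → y ∩ u ≐ y ∩ v
  ∩-congˡ y (u⊆v , v⊆u) = (λ w → map₂ (u⊆v w)) , (λ w → map₂ (v⊆u w))

  -- Adjacency in terms of cardinalities: equal dimensions, and an intersection of codimension one.
  Neighbour : Subspace → Subspace → Set
  Neighbour y z = ∣ z ∣ ≡ ∣ y ∣ × q * ∣ y ∩ z ∣ ≡ ∣ y ∣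

  neighbour? : Decidable₂ Neighbour
  neighbour? y z = ∣ z ∣ ℕ.≟ ∣ y ∣ ×-dec q * ∣ y ∩ z ∣ ℕ.≟ ∣ y ∣

  Neighbour-resp : ∀ y → Neighbour y Respects _≐_
  Neighbour-resp y {u} {v} u≐v (∣u∣≡ , q∣y∩u∣≡) =
    ≡.trans (≡.sym (∣∣-resp {u} {v} u≐v)) ∣u∣≡ ,
    ≡.trans (cong (q *_) (≡.sym (∣∣-resp {y ∩ u} {y ∩ v} (∩-congˡ y {u} {v} u≐v)))) q∣y∩u∣≡

  NeighbourAbove : Subspace → Subspace → Subspace → Set _
  NeighbourAbove y γ z = Neighbour y z × γ ⊆ z

  neighbourAbove? : ∀ y γ → Decidable (NeighbourAbove y γ)
  neighbourAbove? y γ z = neighbour? y z ×-dec γ ⊆? z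

  NeighbourAbove-resp : ∀ y γ → NeighbourAbove y γ Respects _≐_
  NeighbourAbove-resp y γ {u} {v} u≐v (nbr , γ⊆u) =
    Neighbour-resp y {u} {v} u≐v nbr , ⊆-trans {γ} {u} {v} γ⊆u (proj₁ u≐v)

  LowerCoverOf : Subspace → Subspace → Set _
  LowerCoverOf α β = β ⊆ α × q * ∣ β ∣ ≡ ∣ α ∣

  lowerCoverIn? : ∀ α y → Decidable (λ β → LowerCoverOf α β × β ⊆ y)
  lowerCoverIn? α y β = (β ⊆? α ×-dec q * ∣ β ∣ ℕ.≟ ∣ α ∣) ×-dec β ⊆? y

  -- z ↦ y ∩ z is a bijection onto the hyperplanes of y through γ, with inverse H ↦ H + ⟨v⟩.
  #neighbours-through : ∀ r γ y v → γ ⊆ y → ¬ contains y v → ∣ y ∣ ≡ q ^ r * ∣ γ ∣ →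
    #subspaces (λ z → neighbourAbove? y γ z ×-dec Subspace.dec z v) ≡ geometric q r
  #neighbours-through r γ y v γ⊆y v∉y ∣y∣≡ = ≡.trans
    (count-bijection (list subspaces) (list subspaces)
      (λ z H → through? z ×-dec (y ∩ z) ≐? H) through? (hyperplane? γ y) R⇒P×Q
      (λ z Pz → count-unique subspaces (λ H → through? z ×-dec (y ∩ z) ≐? H)
        (λ {H} {H′} H≐H′ (Pz , y∩z≐H) → Pz , ≐-trans {y ∩ z} {H} {H′} y∩z≐H H≐H′)
        (y ∩ z) (Pz , (λ _ → id) , (λ _ → id)) proj₂)
      extension-unique)
    (#hyperplanes r γ y γ⊆y ∣y∣≡)
    where
    Through : Subspace → Set _
    Through z = NeighbourAbove y γ z × contains z v

    through? : Decidable Through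
    through? z = neighbourAbove? y γ z ×-dec Subspace.dec z v

    R⇒P×Q : ∀ z H → Through z × y ∩ z ≐ H → Through z × Hyperplane γ y H
    R⇒P×Q z H (Pz@(((_ , q∣y∩z∣≡) , γ⊆z) , _) , y∩z≐H) = Pz ,
      Hyperplane-resp γ y {y ∩ z} {H} y∩z≐H ((λ w w∈γ → γ⊆y w w∈γ , γ⊆z w w∈γ) , (λ _ → proj₁) , q∣y∩z∣≡)

    extension-unique : ∀ H → Hyperplane γ y H → #subspaces (λ z → through? z ×-dec (y ∩ z) ≐? H) ≡ 1
    extension-unique H (γ⊆H , H⊆y , q∣H∣≡) = count-unique subspaces (λ z → through? z ×-dec (y ∩ z) ≐? H)
      (λ {z} {z′} z≐z′ ((nbr , v∈z) , y∩z⊆H , H⊆y∩z) →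
        (NeighbourAbove-resp y γ {z} {z′} z≐z′ nbr , proj₁ z≐z′ v v∈z) ,
        (λ w (w∈y , w∈z′) → y∩z⊆H w (w∈y , proj₂ z≐z′ w w∈z′)) ,
        (λ w w∈H → map₂ (proj₁ z≐z′ w) (H⊆y∩z w w∈H)))
      H+v
      ((((∣H+v∣ , ≡.trans (cong (q *_) (∣∣-resp {y ∩ H+v} {H} y∩H+v≐H)) q∣H∣≡) ,
        ⊆-trans {γ} {H} {H+v} γ⊆H (⊆-extend H v)) , ∈-extend H v) , y∩H+v≐H)
      -- Any such z contains H and v, hence H + ⟨v⟩, and `∣ z ∣ ≡ ∣ y ∣` leaves no room for more.
      λ {z} ((((∣z∣≡ , _) , _) , v∈z) , _ , H⊆y∩z) →
        let H+v⊆z = extend-⊆ H v {z} (λ w → proj₂ ∘ H⊆y∩z w) v∈z in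
        H+v⊆z , ⊆⇒⊇ {H+v} {z} H+v⊆z (≡.trans ∣H+v∣ (≡.sym ∣z∣≡))
      where
      H+v : Subspace
      H+v = extend H v

      ∣H+v∣ : ∣ H+v ∣ ≡ ∣ y ∣
      ∣H+v∣ = ≡.trans (∣extend∣ H v (v∉y ∘ H⊆y v)) q∣H∣≡

      y∩H+v≐H : y ∩ H+v ≐ H
      y∩H+v≐H = (λ w (w∈y , w∈H+v) → extend-∩ H v {y} H⊆y v∉y w∈H+v w∈y) ,
                (λ w w∈H → H⊆y w w∈H , ⊆-extend H v w w∈H)

  -- Count the pairs (z , v) with v ∈ z ∖ y.
  #neighbours-⊆ : ∀ r M k γ y → γ ⊆ y → ∣ y ∣ ≡ q ^ r * ∣ γ ∣ → ∣ y ∣ ≡ q * k → ∣ whole ∣ ≡ q ^ M * ∣ y ∣ →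
    #subspaces (neighbourAbove? y γ) ≡ q * geometric q M * geometric q r
  #neighbours-⊆ r M k γ y γ⊆y ∣y∣≡ ∣y∣≡qk ∣whole∣≡ =
    -- Every neighbour z has q k vectors, k of them in y, hence (q - 1) k outside; k expresses the
    -- quotient of `∣ y ∣` by q without a division.
    ℕ.*-cancelʳ-≡ _ _ ((q ∸ 1) * k) {{ℕ.m*n≢0 (q ∸ 1) k {{q∸1-nonZero}} {{k-nonZero}}}} (begin
      #subspaces (neighbourAbove? y γ) * ((q ∸ 1) * k)
        ≡⟨ double-count (list subspaces) (list allVectors)
             (λ z v → neighbourAbove? y γ z ×-dec Subspace.dec z v ×-dec ¬? (dec v)) (neighbourAbove? y γ) (¬? ∘ dec)
             (λ z v (nbr , _ , v∉y) → nbr , v∉y) ((q ∸ 1) * k) (geometric q r) vectors-off-y neighbours-through-v ⟩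
      #vectors (¬? ∘ dec) * geometric q r
        ≡⟨ cong (_* geometric q r) (≡.trans
             (count-cong (list allVectors) (¬? ∘ dec) (λ v → yes (lift tt) ×-dec ¬? (dec v)) (lift tt ,_) proj₂)
             (^*-splits M ∣whole∣≡ (∣∣-split {y} {whole} λ _ _ → lift tt))) ⟩
      (q ∸ 1) * geometric q M * ∣ y ∣ * geometric q r
        ≡⟨ cong (λ n → (q ∸ 1) * geometric q M * n * geometric q r) ∣y∣≡qk ⟩
      (q ∸ 1) * geometric q M * (q * k) * geometric q r
        ≡⟨ ring (q ∸ 1) q k (geometric q M) (geometric q r) ⟩
      q * geometric q M * geometric q r * ((q ∸ 1) * k) ∎)
    where
    open ≡.≡-Reasoning
    open Subspace y using (dec)

    ring : ∀ p q k M r → p * M * (q * k) * r ≡ q * M * r * (p * k)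
    ring = solve-∀

    k-nonZero : NonZero k
    k-nonZero = ℕ.m*n≢0⇒n≢0 q {{≡.subst NonZero ∣y∣≡qk (∣∣-nonZero y)}}

    vectors-off-y : ∀ z → NeighbourAbove y γ z →
      #vectors (λ v → neighbourAbove? y γ z ×-dec Subspace.dec z v ×-dec ¬? (dec v)) ≡ (q ∸ 1) * k
    vectors-off-y z nbr@((∣z∣≡ , q∣y∩z∣≡) , _) = ≡.trans
      (count-cong (list allVectors) (λ v → neighbourAbove? y γ z ×-dec Subspace.dec z v ×-dec ¬? (dec v))
        (λ v → Subspace.dec z v ×-dec ¬? (Subspace.dec (y ∩ z) v))
        (λ (_ , v∈z , v∉y) → v∈z , v∉y ∘ proj₁) (λ (v∈z , v∉y∩z) → nbr , v∈z , λ v∈y → v∉y∩z (v∈y , v∈z)))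
      (≡.trans (q*-splits (≡.trans q∣y∩z∣≡ (≡.sym ∣z∣≡)) (∣∣-split {y ∩ z} {z} λ _ → proj₂))
        (cong ((q ∸ 1) *_) (ℕ.*-cancelˡ-≡ _ _ q (≡.trans q∣y∩z∣≡ ∣y∣≡qk))))

    neighbours-through-v : ∀ v → ¬ contains y v →
      #subspaces (λ z → neighbourAbove? y γ z ×-dec Subspace.dec z v ×-dec ¬? (dec v)) ≡ geometric q r
    neighbours-through-v v v∉y = ≡.trans
      (count-cong (list subspaces) (λ z → neighbourAbove? y γ z ×-dec Subspace.dec z v ×-dec ¬? (dec v))
        (λ z → neighbourAbove? y γ z ×-dec Subspace.dec z v)
        (λ (nbr , v∈z , _) → nbr , v∈z) (λ (nbr , v∈z) → nbr , v∈z , v∉y))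
      (#neighbours-through r γ y v γ⊆y v∉y ∣y∣≡)

  -- Lower covers of α are its hyperplanes through zero, which has codimension i in α, and all of
  -- them lie in y.
  #lowerCovers-⊆ : ∀ i α y → ∣ α ∣ ≡ q ^ i → α ⊆ y → #subspaces (lowerCoverIn? α y) ≡ geometric q i
  #lowerCovers-⊆ i α y ∣α∣≡ α⊆y = ≡.trans
    (count-cong (list subspaces) (lowerCoverIn? α y) (hyperplane? trivial α)
      (λ {β} ((β⊆α , q∣β∣≡) , _) → trivial-⊆ β , β⊆α , q∣β∣≡)
      (λ {β} (_ , β⊆α , q∣β∣≡) → (β⊆α , q∣β∣≡) , ⊆-trans {β} {α} {y} β⊆α α⊆y))
    (#hyperplanes i trivial α (trivial-⊆ α)
      (≡.trans ∣α∣≡ (≡.sym (≡.trans (cong (q ^ i *_) ∣trivial∣) (ℕ.*-identityʳ _)))))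

  module _ (α y : Subspace) {v} (v∈α : contains α v) (v∉y : ¬ contains y v) where

    module _ {β} (β⊆α : β ⊆ α) (β⊆y : β ⊆ y) where

      ∣extend∣-off : ∣ extend β v ∣ ≡ q * ∣ β ∣
      ∣extend∣-off = ∣extend∣ β v (v∉y ∘ β⊆y v)

      -- β + ⟨v⟩ lies in α and has its size, so it is α; intersecting with y gives back β.
      lowerCover≐∩ : q * ∣ β ∣ ≡ ∣ α ∣ → β ≐ α ∩ y
      lowerCover≐∩ q∣β∣≡ = (λ w w∈β → β⊆α w w∈β , β⊆y w w∈β) ,
        λ w (w∈α , w∈y) → extend-∩ β v {y} β⊆y v∉y
          (⊆⇒⊇ {extend β v} {α} (extend-⊆ β v {α} β⊆α v∈α) (≡.trans ∣extend∣-off q∣β∣≡) w w∈α) w∈y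

    -- α ⊆ z = (y ∩ z) + ⟨v⟩
    neighbour⇒∩-lowerCover : ∀ {z} → NeighbourAbove y α z → q * ∣ α ∩ y ∣ ≡ ∣ α ∣
    neighbour⇒∩-lowerCover {z} ((∣z∣≡ , q∣y∩z∣≡) , α⊆z) = ≡.trans
      (≡.sym (∣extend∣-off {α ∩ y} (λ _ → proj₁) (λ _ → proj₂)))
      (∣∣-resp {extend (α ∩ y) v} {α} (extend-⊆ (α ∩ y) v {α} (λ _ → proj₁) v∈α , α⊆extend))
      where
      z⊆extend : z ⊆ extend (y ∩ z) v
      z⊆extend = ⊆⇒⊇ {extend (y ∩ z) v} {z} (extend-⊆ (y ∩ z) v {z} (λ _ → proj₂) (α⊆z v v∈α))
        (≡.trans (∣extend∣ (y ∩ z) v (v∉y ∘ proj₁)) (≡.trans q∣y∩z∣≡ (≡.sym ∣z∣≡)))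

      α⊆extend : α ⊆ extend (α ∩ y) v
      α⊆extend w w∈α = let c , w+cv∈y , _ = z⊆extend w (α⊆z w w∈α) in
        c , Subspace.+-closed α w∈α (Subspace.*-closed α c v∈α) , w+cv∈y

    -- Here α = (α ∩ y) + ⟨v⟩, so containing α means containing α ∩ y and v, which is the situation
    -- of `#neighbours-through`.
    #neighbours-∩ : ∀ r → q * ∣ α ∩ y ∣ ≡ ∣ α ∣ → ∣ y ∣ ≡ q ^ r * ∣ α ∩ y ∣ →
      #subspaces (neighbourAbove? y α) ≡ geometric q r
    #neighbours-∩ r q∣α∩y∣≡ ∣y∣≡ = ≡.trans
      (count-cong (list subspaces) (neighbourAbove? y α)
        (λ z → neighbourAbove? y (α ∩ y) z ×-dec Subspace.dec z v)
        (λ (nbr , α⊆z) → (nbr , λ w → α⊆z w ∘ proj₁) , α⊆z v v∈α)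
        (λ {z} ((nbr , α∩y⊆z) , v∈z) → nbr ,
          ⊆-trans {α} {extend (α ∩ y) v} {z} α⊆extend (extend-⊆ (α ∩ y) v {z} α∩y⊆z v∈z)))
      (#neighbours-through r (α ∩ y) y v (λ _ → proj₂) v∉y ∣y∣≡)
      where
      α⊆extend : α ⊆ extend (α ∩ y) v
      α⊆extend = ⊆⇒⊇ {extend (α ∩ y) v} {α} (extend-⊆ (α ∩ y) v {α} (λ _ → proj₁) v∈α)
        (≡.trans (∣extend∣-off {α ∩ y} (λ _ → proj₁) (λ _ → proj₂)) q∣α∩y∣≡)

    #lowerCovers-∩ : q * ∣ α ∩ y ∣ ≡ ∣ α ∣ → #subspaces (lowerCoverIn? α y) ≡ 1
    #lowerCovers-∩ q∣α∩y∣≡ = count-unique subspaces (lowerCoverIn? α y)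
      (λ {β} {β′} β≐β′@(_ , β′⊆β) ((β⊆α , q∣β∣≡) , β⊆y) →
        (⊆-trans {β′} {β} {α} β′⊆β β⊆α , ≡.trans (cong (q *_) (≡.sym (∣∣-resp {β} {β′} β≐β′))) q∣β∣≡) ,
        ⊆-trans {β′} {β} {y} β′⊆β β⊆y)
      (α ∩ y) (((λ _ → proj₁) , q∣α∩y∣≡) , λ _ → proj₂)
      λ {β} ((β⊆α , q∣β∣≡) , β⊆y) → let p , q = lowerCover≐∩ {β} β⊆α β⊆y q∣β∣≡ in q , p

    -- The number of lower covers inside y is 1 if α ∩ y is a hyperplane of α and 0 otherwise, so it
    -- acts as an indicator. In the first case the hypothesis, divided by q, reads
    -- `∣ y ∣ ≡ q ^ r * ∣ α ∩ y ∣`.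
    #neighbours-⊈ : ∀ r → q * ∣ y ∣ ≡ q ^ r * ∣ α ∣ →
      #subspaces (neighbourAbove? y α) ≡ geometric q r * #subspaces (lowerCoverIn? α y)
    #neighbours-⊈ r q∣y∣≡ = case q * ∣ α ∩ y ∣ ℕ.≟ ∣ α ∣ of λ where
        (yes q∣α∩y∣≡) → ≡.trans
          (#neighbours-∩ r q∣α∩y∣≡ (ℕ.*-cancelˡ-≡ _ _ q (≡.trans q∣y∣≡
            (≡.trans (cong (q ^ r *_) (≡.sym q∣α∩y∣≡)) (ring q (q ^ r) ∣ α ∩ y ∣)))))
          (≡.sym (≡.trans (cong (geometric q r *_) (#lowerCovers-∩ q∣α∩y∣≡)) (ℕ.*-identityʳ _)))
        (no q∣α∩y∣≢) → ≡.trans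
          (count-none (list subspaces) (neighbourAbove? y α)
            (All.universal (λ z nbr → q∣α∩y∣≢ (neighbour⇒∩-lowerCover {z} nbr)) (list subspaces)))
          (≡.sym (≡.trans (cong (geometric q r *_)
            (count-none (list subspaces) (lowerCoverIn? α y) (All.universal (none q∣α∩y∣≢) (list subspaces))))
            (ℕ.*-zeroʳ (geometric q r))))
      where
      ring : ∀ q Q g → Q * (q * g) ≡ q * (Q * g)
      ring = solve-∀

      none : ¬ q * ∣ α ∩ y ∣ ≡ ∣ α ∣ → ∀ β → ¬ (LowerCoverOf α β × β ⊆ y)
      none q∣α∩y∣≢ β ((β⊆α , q∣β∣≡) , β⊆y) = q∣α∩y∣≢ (≡.trans
        (cong (q *_) (≡.sym (∣∣-resp {β} {α ∩ y} (lowerCover≐∩ {β} β⊆α β⊆y q∣β∣≡)))) q∣β∣≡)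

  -- The claim at y, with ∣ y ∣ = q ^ D, D = r + i and N = D + M.
  neighbour-recurrence : ∀ i r M k α y → ∣ α ∣ ≡ q ^ i → ∣ y ∣ ≡ q ^ (r + i) → ∣ y ∣ ≡ q * k → ∣ whole ∣ ≡ q ^ M * ∣ y ∣ →
    #subspaces (neighbourAbove? y α) + geometric q i * geometric q (suc r + M) * 𝟙 (α ⊆? y) ≡
    q * geometric q (r + i) * geometric q M * 𝟙 (α ⊆? y) + geometric q (suc r) * #subspaces (lowerCoverIn? α y)
  neighbour-recurrence i r M k α y ∣α∣≡ ∣y∣≡ ∣y∣≡qk ∣whole∣≡ = go (α ⊆? y)
    where
    open ≡.≡-Reasoning
    I G R Q #z #β : ℕ
    I  = geometric q i
    G  = geometric q M
    R  = geometric q r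
    Q  = q ^ r
    #z = #subspaces (neighbourAbove? y α)
    #β = #subspaces (lowerCoverIn? α y)

    q^r*∣α∣ : ∀ r → q ^ (r + i) ≡ q ^ r * ∣ α ∣
    q^r*∣α∣ r = ≡.trans (ℕ.^-distribˡ-+-* q r i) (cong (q ^ r *_) (≡.sym ∣α∣≡))

    -- This is q[M][r] + [i][r + 1 + M] = q[r + i][M] + [r + 1][i], with [r + 1] = R + Q and the
    -- longer sums expanded by `geometric-+`.
    ring-⊆ : ∀ q G R I Q → q * G * R + I * (R + Q + q * Q * G) * 1 ≡ q * (R + Q * I) * G * 1 + (R + Q) * I
    ring-⊆ = solve-∀

    ring-⊈ : ∀ a b c → c + a * 0 ≡ b * 0 + c
    ring-⊈ = solve-∀

    -- The decision is an argument so that matching on it reduces both occurrences of `𝟙`.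
    go : (α⊆?y : Dec (α ⊆ y)) → #z + I * geometric q (suc r + M) * 𝟙 α⊆?y ≡
                                q * geometric q (r + i) * G * 𝟙 α⊆?y + (R + Q) * #β
    go (yes α⊆y) = begin
      #z + I * geometric q (suc r + M) * 1
        ≡⟨ cong₂ (λ a b → a + I * b * 1)
             (#neighbours-⊆ r M k α y α⊆y (≡.trans ∣y∣≡ (q^r*∣α∣ r)) ∣y∣≡qk ∣whole∣≡) (geometric-+ q (suc r) M) ⟩
      q * G * R + I * (R + Q + q * Q * G) * 1
        ≡⟨ ring-⊆ q G R I Q ⟩
      q * (R + Q * I) * G * 1 + (R + Q) * I
        ≡⟨ cong₂ (λ a b → q * a * G * 1 + (R + Q) * b) (geometric-+ q r i) (#lowerCovers-⊆ i α y ∣α∣≡ α⊆y) ⟨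
      q * geometric q (r + i) * G * 1 + (R + Q) * #β ∎
    go (no α⊈y) = let v , v∈α , v∉y = ⊈⇒∃ {α} {y} α⊈y in begin
      #z + I * geometric q (suc r + M) * 0
        ≡⟨ cong (_+ I * geometric q (suc r + M) * 0)
             (#neighbours-⊈ α y v∈α v∉y (suc r) (≡.trans (cong (q *_) ∣y∣≡) (q^r*∣α∣ (suc r)))) ⟩
      (R + Q) * #β + I * geometric q (suc r + M) * 0
        ≡⟨ ring-⊈ (I * geometric q (suc r + M)) (q * geometric q (r + i) * G) ((R + Q) * #β) ⟩
      q * geometric q (r + i) * G * 0 + (R + Q) * #β ∎

-- From cardinalities back to vertices, adjacency and covering

module GrassmannCounts
  (F : HeytingField f ℓ₁ ℓ₂) {q : ℕ} (size : HasSize F q)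
  (𝒱 : VectorSpace F m ℓm) {N : ℕ} (dim𝒱 : LinearAlgebra.HasDim F 𝒱 U N)
  (D : ℕ)
  where

  open Grassmann F size 𝒱 dim𝒱 D
  open Cardinality F size 𝒱 dim𝒱
  open Hyperplanes F size 𝒱 dim𝒱
  open Neighbours F size 𝒱 dim𝒱
  open Enumeration using (list)

  []≡geometric : ∀ ℓ → [ ℓ ] ≡ geometric q ℓ
  []≡geometric ℓ = ≡.trans
    (cong (λ n → _/_ (n ∸ 1) (q ∸ 1) {{q-1≢0}})
      (≡.trans (^-geometric q≡1+p ℓ) (cong suc (ℕ.*-comm (q ∸ 1) (geometric q ℓ)))))
    (m*n/n≡m (geometric q ℓ) (q ∸ 1) {{q-1≢0}})

  dim-monotone : ∀ {u v i j} → dim u ≡ i → dim v ≡ j → u ⊆ v → i ≤ j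
  dim-monotone {u} {v} {i} {j} dimu dimv u⊆v = ℕ.≮⇒≥ λ j<i → ℕ.<-irrefl refl
    (ℕ.<-≤-trans (ℕ.^-monoʳ-< q 1<q j<i) (≡.subst₂ _≤_ (dim⇒∣∣ u dimu) (dim⇒∣∣ v dimv) (∣∣-mono {u} {v} u⊆v)))

  -- The bases demanded of z and of y ∩ z are recovered from cardinalities by `∣∣⇒dim`. Since 1 ≤ D,
  -- `D ∸ 1` is a true predecessor and `q * q ^ (D ∸ 1) ≡ q ^ D`.
  #adjacent : 1 ≤ D → ∀ α (y : Vertex) →
    count (list vertices) (λ z → adjacent? y z ×-dec α ⊆? proj₁ z) ≡ #subspaces (neighbourAbove? (proj₁ y) α)
  #adjacent 1≤D α (y , dimy) = ≡.trans
    (count-restrictList (list subspaces) (λ z → dim? z D) (neighbourAbove? y α)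
      (λ z → adjacent? (y , dimy) z ×-dec α ⊆? proj₁ z)
      (λ { {z , dimz} (dim∩ , α⊆z) → (≡.trans (dim⇒∣∣ z dimz) (≡.sym ∣y∣) ,
             ≡.trans (cong (q *_) (dim⇒∣∣ (y ∩ z) dim∩)) (≡.trans q*q^[D∸1] (≡.sym ∣y∣))) , α⊆z })
      (λ { {z , dimz} ((_ , q∣y∩z∣≡) , α⊆z) → ∣∣⇒dim (y ∩ z)
             (ℕ.*-cancelˡ-≡ _ _ q (≡.trans q∣y∩z∣≡ (≡.trans ∣y∣ (≡.sym q*q^[D∸1])))) , α⊆z }))
    (count-cong (list subspaces) (λ z → dim? z D ×-dec neighbourAbove? y α z) (neighbourAbove? y α)
      proj₂ λ { {z} nbr@((∣z∣≡ , _) , _) → ∣∣⇒dim z (≡.trans ∣z∣≡ ∣y∣) , nbr })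
    where
    ∣y∣ : ∣ y ∣ ≡ q ^ D
    ∣y∣ = dim⇒∣∣ y dimy

    q*q^[D∸1] : q * q ^ (D ∸ 1) ≡ q ^ D
    q*q^[D∸1] = cong (q ^_) (ℕ.m+[n∸m]≡n 1≤D)

  #lowerCovers : ∀ α i → dim α ≡ i → ∀ y →
    count (list (lowerCovers α)) (λ β → proj₁ β ⊆? y) ≡ #subspaces (lowerCoverIn? α y)
  #lowerCovers α i dimα y = ≡.trans
    (count-restrictList (list subspaces) (α covers?_) (_⊆? y) (λ β → proj₁ β ⊆? y) id id)
    (count-cong (list subspaces) (λ β → α covers? β ×-dec β ⊆? y) (lowerCoverIn? α y)
      (λ { {β} ((β⊆α , d , dimβ , dimα′) , β⊆y) →
        (β⊆α , ≡.trans (cong (q *_) (dim⇒∣∣ β dimβ)) (≡.sym (dim⇒∣∣ α dimα′))) , β⊆y })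
      (λ { {β} ((β⊆α , q∣β∣≡) , β⊆y) → (β⊆α , covers β i dimα q∣β∣≡) , β⊆y }))
    where
    covers : ∀ β i → dim α ≡ i → q * ∣ β ∣ ≡ ∣ α ∣ → ∃[ d ] (dim β ≡ d × dim α ≡ suc d)
    -- A zero-dimensional α has one vector, and 1 is not a multiple of q > 1.
    covers β zero    dimα q∣β∣≡ = contradiction
      (ℕ.m*n≡1⇒m≡1 q ∣ β ∣ (≡.trans q∣β∣≡ (dim⇒∣∣ α dimα))) (ℕ.<⇒≢ 1<q ∘ ≡.sym)
    covers β (suc d) dimα q∣β∣≡ = d , ∣∣⇒dim β (ℕ.*-cancelˡ-≡ _ _ q (≡.trans q∣β∣≡ (dim⇒∣∣ α dimα))) , dimα

  -- The coordinate of the claim at y, with the negative part of θ on the left so that both sides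
  -- are natural numbers.
  adjacency-recurrence : 1 ≤ D → D ≤ N → ∀ α i → dim α ≡ i → i ≤ D → (y : Vertex) →
    count (list vertices) (λ z → adjacent? y z ×-dec α ⊆? proj₁ z)
      + [ i ] * [ N ∸ i + 1 ] * 𝟙 (α ⊆? proj₁ y) ≡
    q * [ D ] * [ N ∸ D ] * 𝟙 (α ⊆? proj₁ y)
      + [ D ∸ i + 1 ] * count (list (lowerCovers α)) (λ β → proj₁ β ⊆? proj₁ y)
  adjacency-recurrence 1≤D D≤N α i dimα i≤D y⁺@(y , dimy) = begin
    #z′ + [ i ] * [ N ∸ i + 1 ] * 𝟙 (α ⊆? y)
      ≡⟨ cong₂ (λ c d → c + d * 𝟙 (α ⊆? y)) (#adjacent 1≤D α y⁺)
           (cong₂ _*_ ([]≡geometric i) (≡.trans ([]≡geometric (N ∸ i + 1)) (cong (geometric q) N∸i+1≡))) ⟩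
    #subspaces (neighbourAbove? y α) + geometric q i * geometric q (suc r + M) * 𝟙 (α ⊆? y)
      ≡⟨ neighbour-recurrence i r M (q ^ (D ∸ 1)) α y (dim⇒∣∣ α dimα)
           (≡.trans ∣y∣ (cong (q ^_) (≡.sym r+i≡D)))
           (≡.trans ∣y∣ (cong (q ^_) (≡.sym (ℕ.m+[n∸m]≡n 1≤D))))
           (≡.trans ∣whole∣ (≡.trans (cong (q ^_) (≡.sym M+D≡N))
             (≡.trans (ℕ.^-distribˡ-+-* q M D) (cong (q ^ M *_) (≡.sym ∣y∣))))) ⟩
    q * geometric q (r + i) * geometric q M * 𝟙 (α ⊆? y) + geometric q (suc r) * #subspaces (lowerCoverIn? α y)
      ≡⟨ cong₂ (λ c d → q * c * geometric q M * 𝟙 (α ⊆? y) + d * #subspaces (lowerCoverIn? α y))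
           (≡.trans ([]≡geometric D) (cong (geometric q) (≡.sym r+i≡D)))
           (≡.trans ([]≡geometric (r + 1)) (cong (geometric q) (ℕ.+-comm r 1))) ⟨
    q * [ D ] * geometric q M * 𝟙 (α ⊆? y) + [ D ∸ i + 1 ] * #subspaces (lowerCoverIn? α y)
      ≡⟨ cong₂ (λ c d → q * [ D ] * c * 𝟙 (α ⊆? y) + [ D ∸ i + 1 ] * d) ([]≡geometric M) (#lowerCovers α i dimα y) ⟨
    q * [ D ] * [ M ] * 𝟙 (α ⊆? y) + [ D ∸ i + 1 ] * count (list (lowerCovers α)) (λ β → proj₁ β ⊆? y) ∎
    where
    open ≡.≡-Reasoning
    r M #z′ : ℕ
    r = D ∸ i
    M = N ∸ D
    #z′ = count (list vertices) (λ z → adjacent? y⁺ z ×-dec α ⊆? proj₁ z)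

    r+i≡D : r + i ≡ D
    r+i≡D = ℕ.m∸n+n≡m i≤D

    M+D≡N : M + D ≡ N
    M+D≡N = ℕ.m∸n+n≡m D≤N

    ∣y∣ : ∣ y ∣ ≡ q ^ D
    ∣y∣ = dim⇒∣∣ y dimy

    N∸i+1≡ : N ∸ i + 1 ≡ suc r + M
    N∸i+1≡ = begin
      N ∸ i + 1            ≡⟨ cong (λ n → n ∸ i + 1) (≡.trans (cong (M +_) r+i≡D) M+D≡N) ⟨
      M + (r + i) ∸ i + 1  ≡⟨ cong (λ n → n ∸ i + 1) (ℕ.+-assoc M r i) ⟨
      M + r + i ∸ i + 1    ≡⟨ cong (_+ 1) (ℕ.m+n∸n≡m (M + r) i) ⟩
      M + r + 1            ≡⟨ ℕ.+-comm (M + r) 1 ⟩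
      suc (M + r)          ≡⟨ cong suc (ℕ.+-comm M r) ⟩
      suc (r + M)          ∎

  -- Transport of the identity from ℕ to the coefficient ring

  module _ (K : CommutativeRing k ℓk) where

    open Coefficients K
    open import Data.Integer.Base using (+_)
    private
      module K = CommutativeRing K
    open K using (_≈_; 0#; 1#) renaming (Carrier to 𝕂; _+_ to _⊕_; _*_ to _⊗_)
    open Multiples K.semiring using (×-homo-+; ×1-homo-*) renaming (_×_ to _times_)

    ι : ℕ → 𝕂
    ι n = n times 1#

    ι-𝟙 : {P : Set p} (P? : Dec P) → (if ⌊ P? ⌋ then 1# else 0#) ≈ ι (𝟙 P?)
    ι-𝟙 (yes _) = K.sym (K.+-identityʳ 1#)
    ι-𝟙 (no  _) = K.refl

    𝟙-×-dec : {P : Set p} {Q : Set p₁} (P? : Dec P) (Q? : Dec Q) → 𝟙 P? * 𝟙 Q? ≡ 𝟙 (P? ×-dec Q?)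
    𝟙-×-dec (yes _) (yes _) = refl
    𝟙-×-dec (yes _) (no  _) = refl
    𝟙-×-dec (no  _) _       = refl

    ∑-count : {S : Setoid a ℓ} (E : Enumeration S) {P : Pred (Setoid.Carrier S) p} (P? : Decidable P)
              {g : Setoid.Carrier S → 𝕂} → (∀ s → g s ≈ ι (𝟙 (P? s))) → ∑ E g ≈ ι (count (list E) P?)
    ∑-count E P? {g} g≈ = go (list E)
      where
      go : ∀ xs → foldr (λ s → g s ⊕_) 0# xs ≈ ι (count xs P?)
      go []       = K.refl
      go (x ∷ xs) = K.trans (K.+-cong (g≈ x) (go xs)) (K.sym (×-homo-+ 1# (𝟙 (P? x)) (count xs P?)))

    fromℤ-neg : ∀ n → fromℤ (ℤ.- (+ n)) ≈ K.- ι n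
    fromℤ-neg zero    = K.sym (GroupProperties.ε⁻¹≈ε K.+-group)
    fromℤ-neg (suc n) = K.refl

    -- `fromℤ` is defined by sign, and m - n is either `m ∸ n` or the negative of `n ∸ m`, whence
    -- the two cases. Applied to θ, this restores the subtracted term.
    fromℤ-difference : ∀ m n → fromℤ (+ m ℤ.- + n) ⊕ ι n ≈ ι m
    fromℤ-difference m n = K.trans (K.+-congʳ (K.reflexive (cong fromℤ (ℤ.m-n≡m⊖n m n))))
      ([ ≥-case , <-case ]′ (ℕ.≤-<-connex n m))
      where
      open SetoidReasoning K.setoid

      ≥-case : n ≤ m → fromℤ (m ℤ.⊖ n) ⊕ ι n ≈ ι m
      ≥-case n≤m = begin
        fromℤ (m ℤ.⊖ n) ⊕ ι n      ≡⟨ cong (λ z → fromℤ z ⊕ ι n) (ℤ.⊖-≥ n≤m) ⟩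
        ι (m ∸ n) ⊕ ι n            ≈⟨ ×-homo-+ 1# (m ∸ n) n ⟨
        ι (m ∸ n + n)              ≡⟨ cong ι (ℕ.m∸n+n≡m n≤m) ⟩
        ι m                        ∎

      <-case : m < n → fromℤ (m ℤ.⊖ n) ⊕ ι n ≈ ι m
      <-case m<n = begin
        fromℤ (m ℤ.⊖ n) ⊕ ι n                      ≡⟨ cong₂ (λ z n → fromℤ z ⊕ ι n) (ℤ.⊖-< m<n)
                                                        (≡.sym (ℕ.m+[n∸m]≡n (ℕ.<⇒≤ m<n))) ⟩
        fromℤ (ℤ.- (+ (n ∸ m))) ⊕ ι (m + (n ∸ m))  ≈⟨ K.+-cong (fromℤ-neg (n ∸ m)) (×-homo-+ 1# m (n ∸ m)) ⟩
        K.- ι (n ∸ m) ⊕ (ι m ⊕ ι (n ∸ m))          ≈⟨ K.+-comm _ _ ⟩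
        ι m ⊕ ι (n ∸ m) ⊕ K.- ι (n ∸ m)            ≈⟨ GroupProperties.//-rightDividesʳ K.+-group (ι (n ∸ m)) (ι m) ⟩
        ι m                                        ∎

    -- Among the unit vectors summed, only that of z is nonzero at z, and z occurs in the
    -- enumeration, once, exactly when α ⊆ z.
    ^∨-indicator : ∀ α z → (α ^∨) z ≈ ι (𝟙 (α ⊆? proj₁ z))
    ^∨-indicator α z⁺@(z , _) = K.trans
      (∑-count (verticesAbove α) (λ y → proj₁ (proj₁ y) ≐? z) λ y → ι-𝟙 (proj₁ (proj₁ y) ≐? z))
      (K.reflexive (cong ι (go (α ⊆? z))))
      where
      go : (α⊆?z : Dec (α ⊆ z)) → count (list (verticesAbove α)) (λ y → proj₁ (proj₁ y) ≐? z) ≡ 𝟙 α⊆?z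
      go (yes α⊆z) = count-unique (verticesAbove α) (λ y → proj₁ (proj₁ y) ≐? z)
        (λ {u} {v} (u⊆v , v⊆u) (u⊆z , z⊆u) →
          ⊆-trans {proj₁ (proj₁ v)} {proj₁ (proj₁ u)} {z} v⊆u u⊆z ,
          ⊆-trans {z} {proj₁ (proj₁ u)} {proj₁ (proj₁ v)} z⊆u u⊆v)
        (z⁺ , α⊆z) ((λ _ → id) , (λ _ → id)) (λ (y⊆z , z⊆y) → z⊆y , y⊆z)
      go (no α⊈z) = count-none (list (verticesAbove α)) (λ y → proj₁ (proj₁ y) ≐? z)
        (All.universal (λ ((y , _) , α⊆y) (y⊆z , _) → α⊈z (⊆-trans {α} {y} {z} α⊆y y⊆z)) (list (verticesAbove α)))

    adjacency-eigen-recurrence : 1 ≤ D → D ≤ N → ∀ α i → dim α ≡ i → i ≤ D →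
      A · α ^∨ ≈ⱽ θ i ∙ α ^∨ +ⱽ (+ [ D ∸ i + 1 ]) ∙ ∑ⱽ (lowerCovers α) (λ β → proj₁ β ^∨)
    adjacency-eigen-recurrence 1≤D D≤N α i dimα i≤D y = begin
      (A · α ^∨) y                                     ≈⟨ ∑-count vertices (λ z → adjacent? y z ×-dec α ⊆? proj₁ z) summand ⟩
      ι #z                                             ≈⟨ GroupProperties.∙-cancelʳ K.+-group (ι Y ⊗ ι T) _ _ cast ⟩
      fromℤ (θ i) ⊗ ι T ⊕ ι G ⊗ ι #β                   ≈⟨ K.+-cong (K.*-congˡ (^∨-indicator α y))
                                                            (K.*-congˡ (∑-count (lowerCovers α) (λ β → proj₁ β ⊆? proj₁ y)
                                                              λ β → ^∨-indicator (proj₁ β) y)) ⟨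
      (θ i ∙ α ^∨ +ⱽ (+ G) ∙ ∑ⱽ (lowerCovers α) (λ β → proj₁ β ^∨)) y ∎
      where
      open SetoidReasoning K.setoid
      B Y G T #z #β : ℕ
      B  = q * [ D ] * [ N ∸ D ]
      Y  = [ i ] * [ N ∸ i + 1 ]
      G  = [ D ∸ i + 1 ]
      T  = 𝟙 (α ⊆? proj₁ y)
      #z = count (list vertices) (λ z → adjacent? y z ×-dec α ⊆? proj₁ z)
      #β = count (list (lowerCovers α)) (λ β → proj₁ β ⊆? proj₁ y)

      summand : ∀ z → A y z ⊗ (α ^∨) z ≈ ι (𝟙 (adjacent? y z ×-dec α ⊆? proj₁ z))
      summand z = begin
        A y z ⊗ (α ^∨) z                                       ≈⟨ K.*-cong (ι-𝟙 (adjacent? y z)) (^∨-indicator α z) ⟩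
        ι (𝟙 (adjacent? y z)) ⊗ ι (𝟙 (α ⊆? proj₁ z))           ≈⟨ ×1-homo-* (𝟙 (adjacent? y z)) (𝟙 (α ⊆? proj₁ z)) ⟨
        ι (𝟙 (adjacent? y z) * 𝟙 (α ⊆? proj₁ z))               ≡⟨ cong ι (𝟙-×-dec (adjacent? y z) (α ⊆? proj₁ z)) ⟩
        ι (𝟙 (adjacent? y z ×-dec α ⊆? proj₁ z))               ∎

      -- θ i ∈ ℤ is a difference, so compare both sides after adding ι Y ⊗ ι T.
      cast : ι #z ⊕ ι Y ⊗ ι T ≈ fromℤ (θ i) ⊗ ι T ⊕ ι G ⊗ ι #β ⊕ ι Y ⊗ ι T
      cast = begin
        ι #z ⊕ ι Y ⊗ ι T                                ≈⟨ K.+-congˡ (×1-homo-* Y T) ⟨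
        ι #z ⊕ ι (Y * T)                                ≈⟨ ×-homo-+ 1# #z (Y * T) ⟨
        ι (#z + Y * T)                                  ≡⟨ cong ι (adjacency-recurrence 1≤D D≤N α i dimα i≤D y) ⟩
        ι (B * T + G * #β)                              ≈⟨ ×-homo-+ 1# (B * T) (G * #β) ⟩
        ι (B * T) ⊕ ι (G * #β)                          ≈⟨ K.+-cong (×1-homo-* B T) (×1-homo-* G #β) ⟩
        ι B ⊗ ι T ⊕ ι G ⊗ ι #β                          ≈⟨ K.+-congʳ (K.*-congʳ (fromℤ-difference B Y)) ⟨
        (fromℤ (θ i) ⊕ ι Y) ⊗ ι T ⊕ ι G ⊗ ι #β          ≈⟨ K.+-congʳ (K.distribʳ (ι T) (fromℤ (θ i)) (ι Y)) ⟩
        fromℤ (θ i) ⊗ ι T ⊕ ι Y ⊗ ι T ⊕ ι G ⊗ ι #β      ≈⟨ xy∙z≈xz∙y _ _ _ ⟩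
        fromℤ (θ i) ⊗ ι T ⊕ ι G ⊗ ι #β ⊕ ι Y ⊗ ι T      ∎
        where open CommutativeSemigroupProperties K.+-commutativeSemigroup using (xy∙z≈xz∙y)

open import Data.Integer.Base using (+_)

theorem8p1 : ∀ {f ℓ₁ ℓ₂ m ℓm k ℓk : Level}
    (F : HeytingField f ℓ₁ ℓ₂) (q : ℕ) (size : HasSize F q) → IsPrimePower q →
    (𝒱 : VectorSpace F m ℓm) (N : ℕ) (dim𝒱 : LinearAlgebra.HasDim F 𝒱 U N) →
    (D : ℕ) → 1 ≤ D → N > 2 * D →
    (K : CommutativeRing k ℓk) →
    let open Grassmann F size 𝒱 dim𝒱 D
        open Coefficients K
    in
    (x : Vertex) (α : Subspace) → α ⊆ proj₁ x →
    (i : ℕ) → dim α ≡ i →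
    A · α ^∨ ≈ⱽ θ i ∙ α ^∨ +ⱽ (+ [ D ∸ i + 1 ]) ∙ ∑ⱽ (lowerCovers α) (λ β → proj₁ β ^∨)
theorem8p1 F q size _ 𝒱 N dim𝒱 D 1≤D N>2D K (x , dimx) α α⊆x i dimα =
  -- `2 * D` unfolds to `D + (D + 0)`, which gives D ≤ N; the inclusion of α in x gives i ≤ D.
  adjacency-eigen-recurrence K 1≤D (ℕ.≤-trans (ℕ.m≤m+n D (D + 0)) (ℕ.<⇒≤ N>2D)) α i dimα (dim-monotone {α} {x} dimα dimx α⊆x)
  where open GrassmannCounts F size 𝒱 dim𝒱 D
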